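{- Let $\mathbb{k}$ be a field of characteristic $0$, let $n\ge 0$ and let $\alpha$ be a composition of $n$. Then the $\mathbb{k}$-linear operator $\mathbb{k}\Sigma_n\to\mathbb{k}\Sigma_n$, $\mathbf{F}\mapsto\mathbf{F}\,\widetilde{w}_0\,\widetilde{B}_\alpha$ is diagonalizable, and its eigenvalues are the signed knapsack numbers $\widetilde{n}_\alpha(F)$ of the faces $F\in\Sigma_n$; the algebraic multiplicity of each eigenvalue $\lambda$ is the number of faces $F\in\Sigma_n$ with $\widetilde{n}_\alpha(F)=\lambda$.
   Context: Notation: $[n]=\{1,\ldots,n\}$; $S_n$ is the symmetric group with $(\sigma\tau)(i)=\sigma(\tau(i))$ and $\mathbb{k}S_n$ its group algebra; $w_0(i)=n+1-i$. For a composition $\beta=(\beta_1,\ldots,\beta_k)$ of $n$ (positive integers with sum $n$), let $D(\beta)=\{\beta_1,\beta_1+\beta_2,\ldots,\beta_1+\cdots+\beta_{k-1}\}$ and $B_\beta=\sum_{w\in S_n:\operatorname{Des}w\subseteq D(\beta)}w$, where $\operatorname{Des}w=\{i\in[n-1]:w(i)>w(i+1)\}$. The $B_\beta$ are linearly independent; their span is the descent algebra $\mathcal{D}(S_n)$, and $w_0\in\mathcal{D}(S_n)$. A face (set composition) of $[n]$ is a tuple $F=(F_1,\ldots,F_k)$ of nonempty pairwise disjoint sets with union $[n]$; $\ell(F)=k$, $\operatorname{type}F=(|F_1|,\ldots,|F_k|)$; $\Sigma_n$ is the set of faces. The product of faces $F=(F_1,\ldots,F_k)$ and $G=(G_1,\ldots,G_m)$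 is the tuple of the intersections $F_i\cap G_j$ listed in lexicographic order of $(i,j)$, with empty sets removed; this makes $\Sigma_n$ a monoid with identity $([n])$, and $\mathbb{k}\Sigma_n$ is its monoid algebra. $\widetilde{B}_\beta=\sum_{F\in\Sigma_n:\operatorname{type}F=\beta}F$. Let $\rho:\mathcal{D}(S_n)\to\mathbb{k}\Sigma_n$ be the $\mathbb{k}$-linear map with $\rho(B_\beta)=\widetilde{B}_\beta$ for all compositions $\beta$, and $\widetilde{w}_0:=\rho(w_0)$. $F\preceq G$ means each block of $F$ lies in some block of $G$; $n_\alpha(F)=\#\{G\in\Sigma_n:F\preceq G,\ \operatorname{type}G=\alpha\}$; $\widetilde{n}_\alpha(F)=(-1)^{n-\ell(F)}n_\alpha(F)$. -}

module Defs where

open import Level using (_⊔_) renaming (suc to lsuc)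
open import Algebra.Bundles using (CommutativeRing)
open import Data.Nat using (ℕ; zero; suc; _∸_; _<_; _<?_; _≟_)
open import Data.Bool using (Bool; if_then_else_)
import Data.Bool as Bool
open import Data.Fin using (Fin; toℕ; fromℕ<)
import Data.Fin.Properties as FinP
open import Data.Fin.Subset using (Subset; _∩_; ⋃; ⊤; ∣_∣; Nonempty; Empty; _⊆_)
open import Data.Fin.Subset.Properties using (nonempty?; _⊆?_)
open import Data.Fin.Permutation using (Permutation′; _⟨$⟩ʳ_)
open import Data.List using (List; []; _∷_; map; concatMap; filter; foldr; length; upTo)
open import Data.Nat.ListAction using (sum)
import Data.List.Properties as ListP
import Data.Vec.Properties as VecP
open import Data.List.Relation.Unary.All using (All; all?)
open import Data.List.Relation.Unary.Any using (Any; any?)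
open import Data.List.Relation.Unary.AllPairs using (AllPairs; allPairs?)
open import Data.List.Membership.DecPropositional _≟_ using (_∈_; _∈?_)
open import Data.Product using (Σ; _×_; _,_)
open import Relation.Nullary using (¬_; Dec; does; ¬?)
open import Relation.Nullary.Decidable using (_×-dec_)
open import Relation.Binary.PropositionalEquality using (_≡_)
open import Relation.Binary.Definitions using (DecidableEquality)

record Field c ℓ : Set (lsuc (c ⊔ ℓ)) where
  field
    commutativeRing : CommutativeRing c ℓ
  open CommutativeRing commutativeRing public
  field
    0≉1     : ¬ (0# ≈ 1#)
    inverse : ∀ x → ¬ (x ≈ 0#) → Σ Carrier λ y → x * y ≈ 1#

listsOfLength : ∀ {a} {A : Set a} → ℕ → List A → List (List A)
listsOfLength zero    xs = [] ∷ []
listsOfLength (suc k) xs = concatMap (λ x → map (x ∷_) (listsOfLength k xs)) xs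

allSubsets : (n : ℕ) → List (Subset n)
allSubsets zero    = Data.Vec.[] ∷ []
  where import Data.Vec
allSubsets (suc n) = concatMap (λ p → (Bool.true V.∷ p) ∷ (Bool.false V.∷ p) ∷ []) (allSubsets n)
  where import Data.Vec as V

IsComposition : ℕ → List ℕ → Set
IsComposition n β = All (0 <_) β × sum β ≡ n

isComposition? : ∀ n β → Dec (IsComposition n β)
isComposition? n β = all? (0 <?_) β ×-dec (sum β ≟ n)

-- The list of all compositions of n (each exactly once): every composition
-- of n has length ≤ n and entries ≤ n.
compositions : ℕ → List (List ℕ)
compositions n = filter (isComposition? n)
  (concatMap (λ k → listsOfLength k (upTo (suc n))) (upTo (suc n)))

D : List ℕ → List ℕ
D []            = []
D (b ∷ [])      = []
D (b ∷ c ∷ bs)  = b ∷ map (b Data.Nat.+_) (D (c ∷ bs))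

-- Permutations, descents, w₀.  Positions are 1-based as in the paper:
-- w(i) for i ∈ [n] is  toℕ (w ⟨$⟩ʳ i')  with i' the Fin n of value i-1.

-- value (0-based) of w at 0-based position i (0 outside the range)
valAt : ∀ {n} → Permutation′ n → ℕ → ℕ
valAt {n} w i with i <? n
... | Relation.Nullary.yes p = toℕ (w ⟨$⟩ʳ fromℕ< p)
... | Relation.Nullary.no  _ = 0

-- Des w = { i ∈ [n-1] : w(i) > w(i+1) }, i.e. 0-based values at positions i-1 > i.
Des : ∀ {n} → Permutation′ n → List ℕ
Des {n} w = filter (λ i → valAt w i <? valAt w (i ∸ 1)) (map suc (upTo (n ∸ 1)))

DesIn : ∀ {n} → Permutation′ n → List ℕ → Set
DesIn w β = All (_∈ D β) (Des w)

desIn? : ∀ {n} (w : Permutation′ n) β → Dec (DesIn w β)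
desIn? w β = all? (_∈? D β) (Des w)

-- w₀(i) = n+1-i  (0-based: position i ↦ value n-1-i)
IsW0 : ∀ {n} → Permutation′ n → Set
IsW0 {n} w = ∀ i → toℕ (w ⟨$⟩ʳ i) ≡ n ∸ suc (toℕ i)

isW0? : ∀ {n} (w : Permutation′ n) → Dec (IsW0 w)
isW0? {n} w = FinP.all? (λ i → toℕ (w ⟨$⟩ʳ i) ≟ n ∸ suc (toℕ i))

Face : ℕ → Set
Face n = List (Subset n)

Disjoint : ∀ {n} → Subset n → Subset n → Set
Disjoint p q = Empty (p ∩ q)

_≟ₛ_ : ∀ {n} → DecidableEquality (Subset n)
_≟ₛ_ = VecP.≡-dec Bool._≟_

_≟F_ : ∀ {n} → DecidableEquality (Face n)
_≟F_ = ListP.≡-dec _≟ₛ_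

IsFace : ∀ {n} → Face n → Set
IsFace F = All Nonempty F × AllPairs Disjoint F × ⋃ F ≡ ⊤

isFace? : ∀ {n} (F : Face n) → Dec (IsFace F)
isFace? F = all? nonempty? F ×-dec (allPairs? (λ p q → ¬? (nonempty? (p ∩ q))) F ×-dec (⋃ F ≟ₛ ⊤))

-- Σ_n as a list (each face exactly once): a face has at most n blocks.
faces : (n : ℕ) → List (Face n)
faces n = filter isFace? (concatMap (λ k → listsOfLength k (allSubsets n)) (upTo (suc n)))

ℓ : ∀ {n} → Face n → ℕ
ℓ = length

type : ∀ {n} → Face n → List ℕ
type = map ∣_∣

_·_ : ∀ {n} → Face n → Face n → Face n
F · G = filter nonempty? (concatMap (λ Fi → map (Fi ∩_) G) F)

_⪯_ : ∀ {n} → Face n → Face n → Set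
F ⪯ G = All (λ b → Any (b ⊆_) G) F

_⪯?_ : ∀ {n} (F G : Face n) → Dec (F ⪯ G)
F ⪯? G = all? (λ b → any? (b ⊆?_) G) F

knapsack : ∀ {n} → List ℕ → Face n → ℕ
knapsack {n} α F = length (filter (λ G → (F ⪯? G) ×-dec (ListP.≡-dec _≟_ (type G) α)) (faces n))

-- Linear algebra over a field 𝕜 in 𝕜Σ_n (elements: functions Face n → 𝕜,
-- only their values at genuine faces matter).

module OverField {c ℓ′} (𝕜 : Field c ℓ′) where
  open Field 𝕜

  fromℕ : ℕ → Carrier
  fromℕ zero    = 0#
  fromℕ (suc m) = 1# + fromℕ m

  CharZero : Set ℓ′
  CharZero = ∀ m → ¬ (fromℕ (suc m) ≈ 0#)

  sign : ℕ → Carrier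
  sign zero    = 1#
  sign (suc k) = - sign k

  [_] : ∀ {p} {P : Set p} → Dec P → Carrier
  [ P? ] = if does P? then 1# else 0#

  sumOver : ∀ {a} {A : Set a} → List A → (A → Carrier) → Carrier
  sumOver xs f = foldr (λ x acc → f x + acc) 0# xs

  KΣ : ℕ → Set c
  KΣ n = Face n → Carrier

  _≈ᵥ_ : ∀ {n} → KΣ n → KΣ n → Set ℓ′
  x ≈ᵥ y = ∀ H → IsFace H → x H ≈ y H

  0ᵥ : ∀ {n} → KΣ n
  0ᵥ _ = 0#

  _+ᵥ_ : ∀ {n} → KΣ n → KΣ n → KΣ n
  (x +ᵥ y) H = x H + y H

  _•_ : ∀ {n} → Carrier → KΣ n → KΣ n
  (a • x) H = a * x H

  lincomb : ∀ {n} → (Face n → Carrier) → (Face n → KΣ n) → KΣ n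
  lincomb {n} co v H = sumOver (faces n) (λ F → co F * v F H)

  basis : ∀ {n} → Face n → KΣ n
  basis F H = [ F ≟F H ]

  _⋆_ : ∀ {n} → KΣ n → KΣ n → KΣ n
  _⋆_ {n} x y H = sumOver (faces n) λ F → sumOver (faces n) λ G →
                    [ (F · G) ≟F H ] * (x F * y G)

  B̃ : ∀ {n} → List ℕ → KΣ n
  B̃ β H = [ ListP.≡-dec _≟_ (type H) β ]

  -- γ : (compositions) → 𝕜 are the B-coordinates of w₀ in 𝕜S_n:
  -- for every w ∈ S_n, the coefficient of w in Σ_β γ_β B_β equals that in w₀.
  CoordsOfW0 : (n : ℕ) → (List ℕ → Carrier) → Set ℓ′
  CoordsOfW0 n γ = ∀ (w : Permutation′ n) →
    sumOver (compositions n) (λ β → γ β * [ desIn? w β ]) ≈ [ isW0? w ]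

  -- ρ applied to the element Σ_β γ_β B_β  (so w̃₀ = ρ̃ γ when CoordsOfW0 n γ)
  ρ̃ : (n : ℕ) → (List ℕ → Carrier) → KΣ n
  ρ̃ n γ H = sumOver (compositions n) (λ β → γ β * B̃ β H)

  ñ : ∀ {n} → List ℕ → Face n → Carrier
  ñ {n} α F = sign (n ∸ length F) * fromℕ (knapsack α F)

  -- T is diagonalizable with eigenvalue λ_F on an eigenbasis (v_F)_{F ∈ Σ_n}
  -- indexed by the faces (hence the eigenvalues, with algebraic
  -- multiplicities, are the multiset {λ_F : F ∈ Σ_n}).
  HasEigenbasis : (n : ℕ) → (KΣ n → KΣ n) → (Face n → Carrier) → Set (c ⊔ ℓ′)
  HasEigenbasis n T λ′ = Σ (Face n → KΣ n) λ v →
      (∀ F → IsFace F → T (v F) ≈ᵥ (λ′ F • v F))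
    × (∀ (co : Face n → Carrier) → lincomb co v ≈ᵥ 0ᵥ → ∀ F → IsFace F → co F ≈ 0#)
    × (∀ (x : KΣ n) → Σ (Face n → Carrier) λ co → x ≈ᵥ lincomb co v)

{-# OPTIONS --safe #-}
module Submission where

-- Let w̃₀ = Σ_G (-1)^(n-ℓ(G)) G and let N(F) be the knapsack number of F.  For G of type α either
-- F ⪯ G and FG = F, or N(FG) > N(F), because G itself is a new face above FG.  Hence right
-- multiplication by B̃_α acts on the span of the faces with N(F) = m as the scalar m, modulo faces
-- with larger N.  Right multiplication by w̃₀ is an involution that preserves this filtration, so
-- the operator T of the theorem satisfies T² = m² on the m-th layer, and T ∏_{m≥1} (T² - m²) = 0.
-- In characteristic 0 this polynomial has simple roots, and T is triangular for refinement with
-- diagonal entries ñ_α(F); Lagrange interpolation at ñ_α(F), applied to F, gives the eigenbasis.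
--
-- That w̃₀ is an involution is a convolution argument: the signed sum over the set compositions of
-- a set is the convolution inverse of prepending one possibly empty block, and both the formula
-- F w̃₀ = Σ_{H ≤ F} (-1)^(n-ℓ(H)) H and w̃₀² = 1 follow from uniqueness of inverses.
--
-- All operators are studied through their transposes, acting on functions of faces.

open import Defs
import Level
open import Data.Bool using (Bool; true; false; if_then_else_)
open import Data.Empty using (⊥-elim)
open import Data.Fin using (Fin; zero; suc; toℕ; fromℕ<; inject₁; punchIn) renaming (fromℕ to maxFin)
import Data.Fin.Properties as Finₚ
open import Data.Fin.Permutation using (Permutation′; _⟨$⟩ʳ_; insert; insert-punchIn) renaming (id to idₚ)
open import Data.Fin.Subset using (Subset; _∩_; _∪_; ∁; ⋃; ⊤; ⊥; ∣_∣; Nonempty; _⊆_) renaming (_∈_ to _∈ₛ_)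
import Data.Fin.Subset.Properties as Subₚ
open import Data.Fin.Subset.Properties using (nonempty?; _⊆?_)
open import Data.List using (List; []; _∷_; _++_; map; concatMap; filter; length; upTo; applyUpTo)
import Data.List.Properties as Listₚ
open import Data.List.Membership.Propositional using (_∈_; find)
open import Data.List.Membership.Propositional.Properties using (∈-filter⁻; ∈-filter⁺; ∈-map⁻; ∈-map⁺; ∈-concatMap⁻; ∈-++⁻; ∈-upTo⁺; ∈-upTo⁻)
open import Data.List.Relation.Unary.All using (All; []; _∷_)
import Data.List.Relation.Unary.All as All
open import Data.List.Relation.Unary.AllPairs using (AllPairs; []; _∷_)
open import Data.List.Relation.Unary.Any using (Any; here; there)
import Data.List.Relation.Unary.Any as Any
open import Data.Nat as ℕ using (ℕ; zero; suc; _∸_; _<_; _≤_; _<?_; z≤n; s≤s; z<s; s<s)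
open import Data.Nat.ListAction using (sum)
import Data.Nat.Properties as ℕₚ
open import Data.Product using (Σ; ∃; ∃₂; _×_; _,_; proj₁; proj₂)
open import Data.Sum using (_⊎_; inj₁; inj₂)
open import Data.Unit using (tt) renaming (⊤ to Unit)
open import Data.Vec using ([]; _∷_; here; there; tabulate)
import Data.Vec.Properties as Vecₚ
open import Function using (_∘_)
open import Function.Bundles using (mk⇔)
open import Relation.Binary.Definitions using (DecidableEquality)
open import Relation.Binary.PropositionalEquality using (_≡_; refl; sym; trans; cong; cong₂; subst; subst₂; module ≡-Reasoning)
open import Relation.Nullary using (¬_; Dec; yes; no; does)
open import Relation.Nullary.Decidable using (dec-true; dec-false; does-⇔; _×-dec_)

-- Coinciding values of `ñ` are the obstacle: a triangular operator with repeated diagonal entries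
-- may have Jordan blocks. Hence two filtrations are used. The number of blocks yields the diagonal
-- entries and the unitriangularity of the eigenvectors; the knapsack number yields an annihilating
-- polynomial without repeated roots. On the layer of knapsack number 0 the operator itself, and not
-- only its square, is zero modulo the other layers, which is why 0 stays a simple root. The formula
-- for F w̃₀ rests on a factorisation: for a subset Z, the set compositions with given restrictions
-- h to Z and g to its complement, counted with sign (-1)^ℓ, total (-1)^(ℓ(h)+ℓ(g)). Applied block
-- by block, it turns the signed sum over G of a function of `F · G` into one signed sum for each
-- block of F. Transposition replaces statements modulo a span of faces by statements about
-- functions vanishing on those faces, so that no subspace or quotient is ever formed.

module FieldSums {c ℓ′} (𝕜 : Field c ℓ′) where
  open Field 𝕜 hiding (refl; sym; trans; zero)
  open Field 𝕜 public using () renaming (refl to ≈-refl; sym to ≈-sym; trans to ≈-trans)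
  open OverField 𝕜
  open import Relation.Binary.Reasoning.Setoid setoid
  open import Algebra.Properties.Ring ring using (-0#≈0#; -‿+-comm)
  open import Algebra.Properties.CommutativeSemigroup +-commutativeSemigroup
    using () renaming (interchange to +-interchange)

  private variable
    a b p : Level.Level
    A : Set a
    B : Set b
    P Q : Set p

  -- Indicators, finite sums and enumerations

  [yes] : (P? : Dec P) → P → [ P? ] ≈ 1#
  [yes] P? h rewrite dec-true P? h = ≈-refl

  [no] : (P? : Dec P) → ¬ P → [ P? ] ≈ 0#
  [no] P? h rewrite dec-false P? h = ≈-refl

  [⇔] : (P? : Dec P) (Q? : Dec Q) → (P → Q) → (Q → P) → [ P? ] ≈ [ Q? ]
  [⇔] P? Q? f g rewrite does-⇔ (mk⇔ f g) P? Q? = ≈-refl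

  [yes]* : (P? : Dec P) → P → ∀ x → [ P? ] * x ≈ x
  [yes]* P? h x = ≈-trans (*-congʳ ([yes] P? h)) (*-identityˡ x)

  [no]* : (P? : Dec P) → ¬ P → ∀ x → [ P? ] * x ≈ 0#
  [no]* P? h x = ≈-trans (*-congʳ ([no] P? h)) (zeroˡ x)

  [×] : (P? : Dec P) (Q? : Dec Q) {R : Set p} (R? : Dec R) → (P → Q → R) → (R → P × Q) →
        [ R? ] ≈ [ P? ] * [ Q? ]
  [×] (yes x) (yes y) R? f g = ≈-trans ([yes] R? (f x y)) (≈-sym (*-identityˡ _))
  [×] (yes x) (no ¬y) R? f g = ≈-trans ([no] R? (¬y ∘ proj₂ ∘ g)) (≈-sym (zeroʳ _))
  [×] (no ¬x) Q? R? f g = ≈-trans ([no] R? (¬x ∘ proj₁ ∘ g)) (≈-sym (zeroˡ _))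

  [_]*-cong : (P? : Dec P) {x y : Carrier} → (P → x ≈ y) → [ P? ] * x ≈ [ P? ] * y
  [ yes h ]*-cong f = *-congˡ (f h)
  [ no ¬h ]*-cong f = ≈-trans (zeroˡ _) (≈-sym (zeroˡ _))

  sum-cong∈ : (xs : List A) {f g : A → Carrier} → (∀ {x} → x ∈ xs → f x ≈ g x) →
              sumOver xs f ≈ sumOver xs g
  sum-cong∈ []       e = ≈-refl
  sum-cong∈ (x ∷ xs) e = +-cong (e (here refl)) (sum-cong∈ xs (e ∘ there))

  sum-cong : (xs : List A) {f g : A → Carrier} → (∀ x → f x ≈ g x) → sumOver xs f ≈ sumOver xs g
  sum-cong xs e = sum-cong∈ xs (λ {x} _ → e x)

  sum-zero : (xs : List A) {f : A → Carrier} → (∀ {x} → x ∈ xs → f x ≈ 0#) → sumOver xs f ≈ 0#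
  sum-zero []       e = ≈-refl
  sum-zero (x ∷ xs) e = ≈-trans (+-cong (e (here refl)) (sum-zero xs (e ∘ there))) (+-identityˡ 0#)

  sum-+ : (xs : List A) (f g : A → Carrier) →
          sumOver xs (λ x → f x + g x) ≈ sumOver xs f + sumOver xs g
  sum-+ []       f g = ≈-sym (+-identityˡ 0#)
  sum-+ (x ∷ xs) f g = ≈-trans (+-congˡ (sum-+ xs f g)) (+-interchange _ _ _ _)

  sum-*ˡ : (xs : List A) (k : Carrier) (f : A → Carrier) →
           sumOver xs (λ x → k * f x) ≈ k * sumOver xs f
  sum-*ˡ []       k f = ≈-sym (zeroʳ k)
  sum-*ˡ (x ∷ xs) k f = ≈-trans (+-congˡ (sum-*ˡ xs k f)) (≈-sym (distribˡ k _ _))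

  sum-*ʳ : (xs : List A) (k : Carrier) (f : A → Carrier) →
           sumOver xs (λ x → f x * k) ≈ sumOver xs f * k
  sum-*ʳ xs k f = begin
    sumOver xs (λ x → f x * k) ≈⟨ sum-cong xs (λ x → *-comm (f x) k) ⟩
    sumOver xs (λ x → k * f x) ≈⟨ sum-*ˡ xs k f ⟩
    k * sumOver xs f           ≈⟨ *-comm _ _ ⟩
    sumOver xs f * k           ∎

  sum-neg : (xs : List A) (f : A → Carrier) → sumOver xs (λ x → - f x) ≈ - sumOver xs f
  sum-neg []       f = ≈-sym -0#≈0#
  sum-neg (x ∷ xs) f = ≈-trans (+-congˡ (sum-neg xs f)) (-‿+-comm _ _)

  sum-++ : (xs ys : List A) (f : A → Carrier) → sumOver (xs ++ ys) f ≈ sumOver xs f + sumOver ys f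
  sum-++ []       ys f = ≈-sym (+-identityˡ _)
  sum-++ (x ∷ xs) ys f = ≈-trans (+-congˡ (sum-++ xs ys f)) (≈-sym (+-assoc _ _ _))

  sum-map : (g : A → B) (xs : List A) (f : B → Carrier) → sumOver (map g xs) f ≡ sumOver xs (f ∘ g)
  sum-map g []       f = refl
  sum-map g (x ∷ xs) f = cong (f (g x) +_) (sum-map g xs f)

  sum-concatMap : (g : A → List B) (xs : List A) (f : B → Carrier) →
                  sumOver (concatMap g xs) f ≈ sumOver xs (λ x → sumOver (g x) f)
  sum-concatMap g []       f = ≈-refl
  sum-concatMap g (x ∷ xs) f =
    ≈-trans (sum-++ (g x) (concatMap g xs) f) (+-congˡ (sum-concatMap g xs f))

  sum-filter : {P : A → Set p} (P? : ∀ x → Dec (P x)) (xs : List A) (f : A → Carrier) →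
               sumOver (filter P? xs) f ≈ sumOver xs (λ x → [ P? x ] * f x)
  sum-filter P? []       f = ≈-refl
  sum-filter P? (x ∷ xs) f with does (P? x)
  ... | true  = +-cong (≈-sym (*-identityˡ _)) (sum-filter P? xs f)
  ... | false = ≈-trans (sum-filter P? xs f) (≈-sym (≈-trans (+-congʳ (zeroˡ _)) (+-identityˡ _)))

  sum-swap : (xs : List A) (ys : List B) (f : A → B → Carrier) →
             sumOver xs (λ x → sumOver ys (f x)) ≈ sumOver ys (λ y → sumOver xs (λ x → f x y))
  sum-swap []       ys f = ≈-sym (sum-zero ys (λ _ → ≈-refl))
  sum-swap (x ∷ xs) ys f =
    ≈-trans (+-congˡ (sum-swap xs ys f)) (≈-sym (sum-+ ys (f x) (λ y → sumOver xs (λ x′ → f x′ y))))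

  sum-const : (xs : List A) (k : Carrier) → sumOver xs (λ _ → k) ≈ fromℕ (length xs) * k
  sum-const []       k = ≈-sym (zeroˡ k)
  sum-const (x ∷ xs) k = begin
    k + sumOver xs (λ _ → k)          ≈⟨ +-cong (≈-sym (*-identityˡ k)) (sum-const xs k) ⟩
    1# * k + fromℕ (length xs) * k    ≈⟨ distribʳ k _ _ ⟨
    (1# + fromℕ (length xs)) * k      ∎

  module _ {A : Set a} (_≟_ : DecidableEquality A) where

    -- That xs lists each element once is expressed by the sifting property of the Kronecker delta.
    record Enumerates (P : A → Set p) (xs : List A) : Set (a Level.⊔ p Level.⊔ c Level.⊔ ℓ′) where
      field
        sound : ∀ {x} → x ∈ xs → P x
        sift  : ∀ x → P x → (φ : A → Carrier) → sumOver xs (λ y → [ x ≟ y ] * φ y) ≈ φ x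

    -- Inserting the delta of `ys` into each term and exchanging the sums leaves a delta to be
    -- sifted in `xs`. One listing of the same objects can thus replace another without a bijection
    -- of lists.
    sum-enum : {P : A → Set p} {xs ys : List A} → Enumerates P xs → Enumerates P ys →
               ∀ φ → sumOver xs φ ≈ sumOver ys φ
    sum-enum {xs = xs} {ys} ex ey φ = begin
      sumOver xs φ
        ≈⟨ sum-cong∈ xs (λ {x} m → ≈-sym (sift ey x (sound ex m) φ)) ⟩
      sumOver xs (λ x → sumOver ys (λ y → [ x ≟ y ] * φ y))
        ≈⟨ sum-swap xs ys _ ⟩
      sumOver ys (λ y → sumOver xs (λ x → [ x ≟ y ] * φ y))
        ≈⟨ sum-cong ys (λ y → sum-cong xs (λ x → *-congʳ ([⇔] (x ≟ y) (y ≟ x) sym sym))) ⟩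
      sumOver ys (λ y → sumOver xs (λ x → [ y ≟ x ] * φ y))
        ≈⟨ sum-cong∈ ys (λ {y} m → sift ex y (sound ey m) (λ _ → φ y)) ⟩
      sumOver ys φ ∎
      where open Enumerates

    sift-filter : {P : A → Set p} (P? : ∀ x → Dec (P x)) (xs : List A) (φ : A → Carrier) →
                  ∀ x → P x → sumOver (filter P? xs) (λ y → [ x ≟ y ] * φ y) ≈ sumOver xs (λ y → [ x ≟ y ] * φ y)
    sift-filter P? xs φ x Px = ≈-trans (sum-filter P? xs _) (sum-cong xs λ y → lemma y)
      where
      lemma : ∀ y → [ P? y ] * ([ x ≟ y ] * φ y) ≈ [ x ≟ y ] * φ y
      lemma y with x ≟ y
      ... | yes refl = [yes]* (P? y) Px _
      ... | no  x≢y  = ≈-trans (*-congˡ (zeroˡ _)) (≈-trans (zeroʳ _) (≈-sym (zeroˡ _)))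

  sift-upTo : ∀ N k → k < N → (φ : ℕ → Carrier) → sumOver (upTo N) (λ j → [ k ℕ.≟ j ] * φ j) ≈ φ k
  sift-upTo N k k<N φ = go N k k<N (λ j → j) (λ e → e)
    where
    -- `upTo` unfolds to `applyUpTo` with the identity, and the recursion replaces `g` by `g ∘ suc`;
    -- injectivity survives this and excludes a second match.
    go : ∀ N k → k < N → (g : ℕ → ℕ) → (∀ {i j} → g i ≡ g j → i ≡ j) →
         sumOver (applyUpTo g N) (λ j → [ g k ℕ.≟ j ] * φ j) ≈ φ (g k)
    go (suc N) zero    _ g inj = begin
      [ g 0 ℕ.≟ g 0 ] * φ (g 0) + sumOver (applyUpTo (g ∘ suc) N) (λ j → [ g 0 ℕ.≟ j ] * φ j)
        ≈⟨ +-cong ([yes]* (g 0 ℕ.≟ g 0) refl _) (rest N (g ∘ suc) λ i e → 0≢suc (inj e)) ⟩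
      φ (g 0) + 0# ≈⟨ +-identityʳ _ ⟩
      φ (g 0) ∎
      where
      0≢suc : ∀ {i} → ¬ 0 ≡ suc i
      0≢suc ()
      rest : ∀ N (h : ℕ → ℕ) → (∀ i → ¬ g 0 ≡ h i) →
             sumOver (applyUpTo h N) (λ j → [ g 0 ℕ.≟ j ] * φ j) ≈ 0#
      rest zero    h ne = ≈-refl
      rest (suc N) h ne =
        ≈-trans (+-cong ([no]* (g 0 ℕ.≟ h 0) (ne 0) _) (rest N (h ∘ suc) (ne ∘ suc))) (+-identityˡ _)
    go (suc N) (suc k) (s≤s k<N) g inj =
      ≈-trans (+-cong ([no]* (g (suc k) ℕ.≟ g 0) (λ e → suc≢0 (inj e)) _) (go N k k<N (g ∘ suc) (ℕₚ.suc-injective ∘ inj)))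
              (+-identityˡ _)
      where
      suc≢0 : ¬ suc k ≡ 0
      suc≢0 ()

  module _ {A : Set a} (_≟_ : DecidableEquality A) {P : A → Set p} {xs : List A}
           (ex : Enumerates _≟_ P xs) where
    open Enumerates
    private
      _≟ₗ_ : DecidableEquality (List A)
      _≟ₗ_ = Listₚ.≡-dec _≟_

    -- The indicator on the right makes the claim hold for every `k`, so that the sum over all
    -- lengths in `enum-lists` is again a sifting.
    sift-listsOfLength : ∀ L → All P L → ∀ k (φ : List A → Carrier) →
      sumOver (listsOfLength k xs) (λ M → [ L ≟ₗ M ] * φ M) ≈ [ length L ℕ.≟ k ] * φ L
    sift-listsOfLength [] _ zero φ = +-identityʳ _
    sift-listsOfLength (x ∷ L) _ zero φ =
      ≈-trans (+-identityʳ _) (≈-trans ([no]* ((x ∷ L) ≟ₗ []) (λ ()) _) (≈-sym ([no]* (length (x ∷ L) ℕ.≟ 0) (λ ()) (φ (x ∷ L)))))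
    sift-listsOfLength [] _ (suc k) φ = ≈-trans
      (sum-concatMap _ xs _)
      (≈-trans (sum-zero xs λ {x} _ → ≈-trans (reflexive (sum-map (x ∷_) (listsOfLength k xs) _))
                                     (sum-zero (listsOfLength k xs) λ {M} _ → [no]* ([] ≟ₗ (x ∷ M)) (λ ()) _))
               (≈-sym ([no]* (0 ℕ.≟ suc k) (λ ()) _)))
    sift-listsOfLength (x ∷ L) (px ∷ pL) (suc k) φ = begin
      sumOver (listsOfLength (suc k) xs) (λ M → [ (x ∷ L) ≟ₗ M ] * φ M)
        ≈⟨ sum-concatMap _ xs _ ⟩
      sumOver xs (λ y → sumOver (map (y ∷_) (listsOfLength k xs)) (λ M → [ (x ∷ L) ≟ₗ M ] * φ M))
        ≈⟨ sum-cong xs (λ y → reflexive (sum-map (y ∷_) (listsOfLength k xs) _)) ⟩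
      sumOver xs (λ y → sumOver (listsOfLength k xs) (λ M → [ (x ∷ L) ≟ₗ (y ∷ M) ] * φ (y ∷ M)))
        ≈⟨ sum-cong xs (λ y → sum-cong (listsOfLength k xs) λ M →
             ≈-trans (*-congʳ ([×] (x ≟ y) (L ≟ₗ M) ((x ∷ L) ≟ₗ (y ∷ M)) (λ { refl refl → refl }) (λ { refl → refl , refl })))
                     (*-assoc _ _ _)) ⟩
      sumOver xs (λ y → sumOver (listsOfLength k xs) (λ M → [ x ≟ y ] * ([ L ≟ₗ M ] * φ (y ∷ M))))
        ≈⟨ sum-cong xs (λ y → sum-*ˡ (listsOfLength k xs) _ _) ⟩
      sumOver xs (λ y → [ x ≟ y ] * sumOver (listsOfLength k xs) (λ M → [ L ≟ₗ M ] * φ (y ∷ M)))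
        ≈⟨ sift ex x px _ ⟩
      sumOver (listsOfLength k xs) (λ M → [ L ≟ₗ M ] * φ (x ∷ M))
        ≈⟨ sift-listsOfLength L pL k (φ ∘ (x ∷_)) ⟩
      [ length L ℕ.≟ k ] * φ (x ∷ L)
        ≈⟨ *-congʳ ([⇔] (length L ℕ.≟ k) (length (x ∷ L) ℕ.≟ suc k) (cong suc) ℕₚ.suc-injective) ⟩
      [ length (x ∷ L) ℕ.≟ suc k ] * φ (x ∷ L) ∎

    -- `faces` and `compositions` both list all short words over a finite alphabet and filter them;
    -- this covers the two at once.
    enum-lists : {Q : List A → Set b} (Q? : ∀ L → Dec (Q L)) (N : ℕ) →
      (∀ L → Q L → All P L × length L < N) →
      Enumerates _≟ₗ_ Q (filter Q? (concatMap (λ k → listsOfLength k xs) (upTo N)))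
    enum-lists Q? N bound .sound m =
      proj₂ (∈-filter⁻ Q? {xs = concatMap (λ k → listsOfLength k xs) (upTo N)} m)
    enum-lists Q? N bound .sift L QL φ = begin
      sumOver (filter Q? lists) (λ M → [ L ≟ₗ M ] * φ M)
        ≈⟨ sift-filter _≟ₗ_ Q? lists φ L QL ⟩
      sumOver lists (λ M → [ L ≟ₗ M ] * φ M)
        ≈⟨ sum-concatMap _ (upTo N) _ ⟩
      sumOver (upTo N) (λ k → sumOver (listsOfLength k xs) (λ M → [ L ≟ₗ M ] * φ M))
        ≈⟨ sum-cong (upTo N) (λ k → sift-listsOfLength L (proj₁ (bound L QL)) k φ) ⟩
      sumOver (upTo N) (λ k → [ length L ℕ.≟ k ] * φ L)
        ≈⟨ sift-upTo N (length L) (proj₂ (bound L QL)) (λ _ → φ L) ⟩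
      φ L ∎
      where lists = concatMap (λ k → listsOfLength k xs) (upTo N)

-- Disjoint splittings of a subset and set compositions

private variable
  m n : ℕ
  A X p q r s : Subset n
  F G h k : Face n

-- A certificate, position by position, that `A` is the disjoint union of `p` and `q`; as an
-- inductive family it turns set identities into structural recursion.
data Split : Subset n → Subset n → Subset n → Set where
  []    : Split [] [] []
  off   : Split A p q → Split (false ∷ A) (false ∷ p) (false ∷ q)
  left  : Split A p q → Split (true ∷ A) (true ∷ p) (false ∷ q)
  right : Split A p q → Split (true ∷ A) (false ∷ p) (true ∷ q)

split-∪ : Split A p q → p ∪ q ≡ A
split-∪ []        = refl
split-∪ (off s)   = cong (false ∷_) (split-∪ s)
split-∪ (left s)  = cong (true ∷_) (split-∪ s)
split-∪ (right s) = cong (true ∷_) (split-∪ s)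

split-disjoint : Split A p q → ∀ {i} → i ∈ₛ p → ¬ i ∈ₛ q
split-disjoint (off s)   (there i) (there j) = split-disjoint s i j
split-disjoint (left s)  (there i) (there j) = split-disjoint s i j
split-disjoint (right s) (there i) (there j) = split-disjoint s i j

disjoint-split : (p q : Subset n) → Disjoint p q → Split (p ∪ q) p q
disjoint-split []          []          d = []
disjoint-split (false ∷ p) (false ∷ q) d = off (disjoint-split p q λ { (i , m) → d (suc i , there m) })
disjoint-split (true ∷ p)  (false ∷ q) d = left (disjoint-split p q λ { (i , m) → d (suc i , there m) })
disjoint-split (false ∷ p) (true ∷ q)  d = right (disjoint-split p q λ { (i , m) → d (suc i , there m) })
disjoint-split (true ∷ p)  (true ∷ q)  d = ⊥-elim (d (zero , here))

split-size : Split A p q → ∣ A ∣ ≡ ∣ p ∣ ℕ.+ ∣ q ∣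
split-size []        = refl
split-size (off s)   = split-size s
split-size (left s)  = cong suc (split-size s)
split-size (right {p = p} {q = q} s) = trans (cong suc (split-size s)) (sym (ℕₚ.+-suc ∣ p ∣ ∣ q ∣))

split-⊥ˡ : Split A ⊥ q → A ≡ q
split-⊥ˡ []        = refl
split-⊥ˡ (off s)   = cong (false ∷_) (split-⊥ˡ s)
split-⊥ˡ (right s) = cong (true ∷_) (split-⊥ˡ s)

split-⊥ʳ : Split A p ⊥ → A ≡ p
split-⊥ʳ []       = refl
split-⊥ʳ (off s)  = cong (false ∷_) (split-⊥ʳ s)
split-⊥ʳ (left s) = cong (true ∷_) (split-⊥ʳ s)

split-⊥ : Split ⊥ p q → p ≡ ⊥ × q ≡ ⊥
split-⊥ []      = refl , refl
split-⊥ (off s) with split-⊥ s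
... | refl , refl = refl , refl

⊥-split : (A : Subset n) → Split A ⊥ A
⊥-split []          = []
⊥-split (false ∷ A) = off (⊥-split A)
⊥-split (true ∷ A)  = right (⊥-split A)

split-assoc : Split A p q → Split p r s → ∃ λ t → Split A r t × Split t s q
split-assoc []        []        = [] , [] , []
split-assoc (off S)   (off T)   with split-assoc S T
... | t , U , V = false ∷ t , off U , off V
split-assoc (left S)  (left T)  with split-assoc S T
... | t , U , V = false ∷ t , left U , off V
split-assoc (left S)  (right T) with split-assoc S T
... | t , U , V = true ∷ t , right U , left V
split-assoc (right S) (off T)   with split-assoc S T
... | t , U , V = true ∷ t , right U , right V

split-∩ : (X : Subset n) → Split A p q → Split (X ∩ A) (X ∩ p) (X ∩ q)
split-∩ []          []        = []
split-∩ (false ∷ X) (off s)   = off (split-∩ X s)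
split-∩ (false ∷ X) (left s)  = off (split-∩ X s)
split-∩ (false ∷ X) (right s) = off (split-∩ X s)
split-∩ (true ∷ X)  (off s)   = off (split-∩ X s)
split-∩ (true ∷ X)  (left s)  = left (split-∩ X s)
split-∩ (true ∷ X)  (right s) = right (split-∩ X s)

nonempty-size : Nonempty p → 0 < ∣ p ∣
nonempty-size (_ , here) = z<s
nonempty-size {p = b ∷ p} (_ , there m) =
  ℕₚ.≤-trans (nonempty-size (_ , m)) (Subₚ.∣p∣≤∣x∷p∣ b p)

¬nonempty-⊥ : ¬ Nonempty (⊥ {n})
¬nonempty-⊥ (_ , m) = Subₚ.∉⊥ m

-- The conditions of IsFace (all blocks nonempty, disjoint, with a given union), peeled block by block.
FaceOf : Subset n → Face n → Set
FaceOf A []      = A ≡ ⊥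
FaceOf A (p ∷ h) = Nonempty p × ∃ λ q → Split A p q × FaceOf q h

faceOf-⋃ : FaceOf A h → ⋃ h ≡ A
faceOf-⋃ {h = []}    refl             = refl
faceOf-⋃ {h = p ∷ h} (_ , q , s , fh) = trans (cong (p ∪_) (faceOf-⋃ fh)) (split-∪ s)

∈⇒⊆⋃ : p ∈ h → p ⊆ ⋃ h
∈⇒⊆⋃ {h = p ∷ h} (here refl) i = Subₚ.p⊆p∪q (⋃ h) i
∈⇒⊆⋃ {h = r ∷ h} (there m)   i = Subₚ.q⊆p∪q r (⋃ h) (∈⇒⊆⋃ m i)

faceOf-∈ : FaceOf A h → p ∈ h → p ⊆ A
faceOf-∈ {h = h} f m i = subst (_ ∈ₛ_) (faceOf-⋃ {h = h} f) (∈⇒⊆⋃ m i)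

⋃-disjoint : All (Disjoint p) h → Disjoint p (⋃ h)
⋃-disjoint {p = p} {h = []} [] (i , m) = Subₚ.∉⊥ (proj₂ (Subₚ.x∈p∩q⁻ p ⊥ m))
⋃-disjoint {p = p} {h = q ∷ h} (d ∷ ds) (i , m)
  with Subₚ.x∈p∩q⁻ p (q ∪ ⋃ h) m
... | i∈p , i∈ with Subₚ.x∈p∪q⁻ q (⋃ h) i∈
...   | inj₁ i∈q = d (i , Subₚ.x∈p∩q⁺ (i∈p , i∈q))
...   | inj₂ i∈⋃ = ⋃-disjoint ds (i , Subₚ.x∈p∩q⁺ (i∈p , i∈⋃))

isFace⇒faceOf-⋃ : (h : Face n) → All Nonempty h → AllPairs Disjoint h → FaceOf (⋃ h) h
isFace⇒faceOf-⋃ []      _        _        = refl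
isFace⇒faceOf-⋃ (p ∷ h) (x ∷ xs) (d ∷ ds) =
  x , ⋃ h , disjoint-split p (⋃ h) (⋃-disjoint d) , isFace⇒faceOf-⋃ h xs ds

isFace⇒faceOf : {F : Face n} → IsFace F → FaceOf ⊤ F
isFace⇒faceOf {F = F} (ne , d , e) = subst (λ A → FaceOf A F) e (isFace⇒faceOf-⋃ F ne d)

faceOf-nonempty : FaceOf A h → All Nonempty h
faceOf-nonempty {h = []}    _                = []
faceOf-nonempty {h = p ∷ h} (x , q , s , fh) = x ∷ faceOf-nonempty fh

faceOf-disjoint : FaceOf A h → AllPairs Disjoint h
faceOf-disjoint {h = []}    _                = []
faceOf-disjoint {h = p ∷ h} (x , q , s , fh) =
  All.tabulate (λ {r} m → λ { (i , i∈) → split-disjoint s (proj₁ (Subₚ.x∈p∩q⁻ p r i∈))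
                                           (faceOf-∈ fh m (proj₂ (Subₚ.x∈p∩q⁻ p r i∈))) })
  ∷ faceOf-disjoint fh

faceOf⇒isFace : {F : Face n} → FaceOf ⊤ F → IsFace F
faceOf⇒isFace {F = F} f = faceOf-nonempty f , faceOf-disjoint f , faceOf-⋃ {h = F} f

faceOf-length : FaceOf A h → length h ≤ ∣ A ∣
faceOf-length {h = []}    _ = z≤n
faceOf-length {A = A} {h = p ∷ h} (x , q , s , fh) = begin
  suc (length h)     ≤⟨ ℕₚ.+-mono-≤ (nonempty-size x) (faceOf-length fh) ⟩
  ∣ p ∣ ℕ.+ ∣ q ∣      ≡⟨ split-size s ⟨
  ∣ A ∣              ∎
  where open ℕₚ.≤-Reasoning

isFace-length : {F : Face n} → IsFace F → length F ≤ n
isFace-length {n} {F} f = subst (length F ≤_) (Subₚ.∣⊤∣≡n n) (faceOf-length (isFace⇒faceOf f))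

faceOf-++ : Split A p q → FaceOf p h → FaceOf q k → FaceOf A (h ++ k)
faceOf-++ {h = []} {k = k} s refl fk = subst (λ A → FaceOf A k) (sym (split-⊥ˡ s)) fk
faceOf-++ {h = r ∷ h} {k = k} s (x , t , s′ , fh) fk with split-assoc s s′
... | u , U , V = x , u , U , faceOf-++ {h = h} V fh fk

-- Restriction of faces and the face product

consNE : Subset n → Face n → Face n
consNE p h = if does (nonempty? p) then p ∷ h else h

consNE-⊥ : (h : Face n) → consNE ⊥ h ≡ h
consNE-⊥ {n} h rewrite dec-false (nonempty? (⊥ {n})) ¬nonempty-⊥ = refl

consNE-nonempty : Nonempty p → (h : Face n) → consNE p h ≡ p ∷ h
consNE-nonempty {p = p} x h rewrite dec-true (nonempty? p) x = refl

empty⇒⊥ : ¬ Nonempty p → p ≡ ⊥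
empty⇒⊥ ¬x = Subₚ.Empty-unique ¬x

faceOf-consNE : Split A p q → FaceOf q h → FaceOf A (consNE p h)
faceOf-consNE {p = p} {h = h} s f with nonempty? p
... | yes x = x , _ , s , f
... | no ¬x = subst (λ A → FaceOf A h)
                (sym (split-⊥ˡ (subst (λ p → Split _ p _) (empty⇒⊥ ¬x) s))) f

-- The consecutive blocks that one block `X` of `F` contributes to `F · G`; equally, the set
-- composition of `X` induced by `G`.
res : Subset n → Face n → Face n
res X G = filter nonempty? (map (X ∩_) G)

filter-∷ : (p : Subset n) (h : Face n) → filter nonempty? (p ∷ h) ≡ consNE p (filter nonempty? h)
filter-∷ p h with does (nonempty? p)
... | true  = refl
... | false = refl

res-∷ : (X p : Subset n) (G : Face n) → res X (p ∷ G) ≡ consNE (X ∩ p) (res X G)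
res-∷ X p G = filter-∷ (X ∩ p) (map (X ∩_) G)

res-consNE : (X p : Subset n) (G : Face n) → res X (consNE p G) ≡ consNE (X ∩ p) (res X G)
res-consNE {n} X p G with nonempty? p
... | yes x = res-∷ X p G
... | no ¬x rewrite empty⇒⊥ ¬x | Subₚ.∩-zeroʳ X = sym (consNE-⊥ (res X G))

faceOf-res : (X : Subset n) → FaceOf A G → FaceOf (X ∩ A) (res X G)
faceOf-res {G = []} X refl = Subₚ.∩-zeroʳ X
faceOf-res {G = p ∷ G} X (x , q , s , f) =
  subst (FaceOf _) (sym (res-∷ X p G)) (faceOf-consNE (split-∩ X s) (faceOf-res X f))

·-∷ : (X : Subset n) (F G : Face n) → (X ∷ F) · G ≡ res X G ++ F · G
·-∷ X F G = Listₚ.filter-++ nonempty? (map (X ∩_) G) (concatMap (λ Fi → map (Fi ∩_) G) F)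

res-face : (X : Subset n) → IsFace G → FaceOf X (res X G)
res-face {G = G} X g = subst (λ A → FaceOf A (res X G)) (Subₚ.∩-identityʳ X) (faceOf-res {G = G} X (isFace⇒faceOf g))

faceOf-· : FaceOf A F → IsFace G → FaceOf A (F · G)
faceOf-· {F = []}    refl            g = refl
faceOf-· {F = X ∷ F} {G = G} (x , q , s , f) g =
  subst (FaceOf _) (sym (·-∷ X F G)) (faceOf-++ {h = res X G} s (res-face X g) (faceOf-· f g))

isFace-· : {F G : Face n} → IsFace F → IsFace G → IsFace (F · G)
isFace-· f g = faceOf⇒isFace (faceOf-· (isFace⇒faceOf f) g)

∈-·⁻ : (F G : Face n) → p ∈ F · G → ∃₂ λ f g → f ∈ F × g ∈ G × p ≡ f ∩ g
∈-·⁻ {n} {p} (X ∷ F) G m = go (∈-split (subst (p ∈_) (·-∷ X F G) m))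
  where
  ∈-split : p ∈ res X G ++ F · G → p ∈ res X G ⊎ p ∈ F · G
  ∈-split = ∈-++⁻ (res X G)
  go : p ∈ res X G ⊎ p ∈ F · G → ∃₂ λ f g → f ∈ X ∷ F × g ∈ G × p ≡ f ∩ g
  go (inj₁ m) with ∈-map⁻ (X ∩_) (proj₁ (∈-filter⁻ nonempty? {xs = map (X ∩_) G} m))
  ... | g , g∈ , e = X , g , here refl , g∈ , e
  go (inj₂ m) with ∈-·⁻ F G m
  ... | f , g , f∈ , g∈ , e = f , g , there f∈ , g∈ , e

·-⪯ʳ : (F G : Face n) → (F · G) ⪯ G
·-⪯ʳ F G = All.tabulate λ m → let f , g , _ , g∈ , e = ∈-·⁻ F G m in
  Any.map (λ { refl {i} i∈ → Subₚ.p∩q⊆q f g (subst (i ∈ₛ_) e i∈) }) g∈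

·-⪯ˡ : (F G : Face n) → (F · G) ⪯ F
·-⪯ˡ F G = All.tabulate λ m → let f , g , f∈ , _ , e = ∈-·⁻ F G m in
  Any.map (λ { refl {i} i∈ → Subₚ.p∩q⊆p f g (subst (i ∈ₛ_) e i∈) }) f∈

⪯-trans : (F G H : Face n) → F ⪯ G → G ⪯ H → F ⪯ H
⪯-trans F G H fg gh = All.map (λ a → lookup a gh) fg
  where
  lookup : ∀ {p G} → Any (p ⊆_) G → All (λ b → Any (b ⊆_) H) G → Any (p ⊆_) H
  lookup (here s)  (b ∷ _)  = Any.map (λ t {i} i∈ → t (s i∈)) b
  lookup (there a) (_ ∷ bs) = lookup a bs

-- A block equal to the whole set leaves nothing for the blocks disjoint from it, and blocks are
-- nonempty.
faceOf-whole : FaceOf X h → Nonempty X → X ∈ h → h ≡ X ∷ []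
faceOf-whole {X = X} {h = p ∷ h} (x , q , s , f) nx (here refl) = cong (X ∷_) (tail-empty h f)
  where
  q≡⊥ : q ≡ ⊥
  q≡⊥ = empty⇒⊥ λ { (i , m) → split-disjoint s (subst (_ ∈ₛ_) (split-∪ s) (Subₚ.q⊆p∪q X q m)) m }
  tail-empty : ∀ h → FaceOf q h → h ≡ []
  tail-empty [] _ = refl
  tail-empty (r ∷ h) (y , _ , s′ , _) =
    ⊥-elim (¬nonempty-⊥ (subst Nonempty (proj₁ (split-⊥ (subst (λ q → Split q r _) q≡⊥ s′))) y))
faceOf-whole {X = X} {h = p ∷ h} ((i , i∈p) , q , s , f) nx (there m) =
  ⊥-elim (split-disjoint s i∈p (faceOf-∈ f m (subst (_ ∈ₛ_) (split-∪ s) (Subₚ.p⊆p∪q q i∈p))))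

res-⊆ : IsFace G → Nonempty X → Any (X ⊆_) G → res X G ≡ X ∷ []
res-⊆ {G = G} {X = X} g nx a = faceOf-whole (res-face X g) nx X∈
  where
  Y∈ = find a
  X∩Y : X ∩ proj₁ Y∈ ≡ X
  X∩Y = Subₚ.⊆-antisym (Subₚ.p∩q⊆p _ _) (λ i → Subₚ.x∈p∩q⁺ (i , proj₂ (proj₂ Y∈) i))
  X∈ : X ∈ res X G
  X∈ = subst (_∈ res X G) X∩Y
         (∈-filter⁺ nonempty? (∈-map⁺ (X ∩_) (proj₁ (proj₂ Y∈))) (subst Nonempty (sym X∩Y) nx))

⪯⇒·≡ : FaceOf A F → IsFace G → F ⪯ G → F · G ≡ F
⪯⇒·≡ {F = []}    _ g [] = refl
⪯⇒·≡ {F = X ∷ F} {G = G} (x , q , s , f) g (a ∷ as) =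
  trans (·-∷ X F G) (cong₂ _++_ (res-⊆ g x a) (⪯⇒·≡ f g as))

-- Each block `X` of `F` contributes at least one block, because `res X G` covers the nonempty set
-- `X`, and a single contribution has to be `X` itself.
·-longer : FaceOf A F → IsFace G → F · G ≡ F ⊎ length F < length (F · G)
·-longer {F = []} f g = inj₁ refl
·-longer {F = X ∷ F} {G = G} (x , q , s , f) g rewrite ·-∷ X F G
  with res X G | res-face X g | ·-longer f g
... | [] | refl | _ = ⊥-elim (¬nonempty-⊥ x)
... | Y ∷ [] | y , _ , s′ , refl | inj₁ e = inj₁ (cong₂ _∷_ (sym (split-⊥ʳ s′)) e)
... | Y ∷ [] | _ | inj₂ lt = inj₂ (s<s lt)
... | Y ∷ Z ∷ h | _ | d = inj₂ (s<s (s≤s (ℕₚ.≤-trans (weak d) len)))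
  where
  weak : F · G ≡ F ⊎ length F < length (F · G) → length F ≤ length (F · G)
  weak (inj₁ e)  = ℕₚ.≤-reflexive (cong length (sym e))
  weak (inj₂ lt) = ℕₚ.<⇒≤ lt
  len : length (F · G) ≤ length (h ++ F · G)
  len = subst (length (F · G) ≤_) (sym (Listₚ.length-++ h)) (ℕₚ.m≤n+m _ (length h))

⋠⇒longer : {F G : Face n} → IsFace F → IsFace G → ¬ F ⪯ G → length F < length (F · G)
⋠⇒longer {F = F} {G} f g ¬⪯ with ·-longer (isFace⇒faceOf f) g
... | inj₁ e  = ⊥-elim (¬⪯ (subst (_⪯ G) e (·-⪯ʳ F G)))
... | inj₂ lt = lt

res-res : (X Y : Subset n) (G : Face n) → res X (res Y G) ≡ res (X ∩ Y) G
res-res X Y []      = refl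
res-res X Y (p ∷ G) = begin
  res X (res Y (p ∷ G))                    ≡⟨ cong (res X) (res-∷ Y p G) ⟩
  res X (consNE (Y ∩ p) (res Y G))         ≡⟨ res-consNE X (Y ∩ p) (res Y G) ⟩
  consNE (X ∩ Y ∩ p) (res X (res Y G))     ≡⟨ cong₂ consNE (sym (Subₚ.∩-assoc X Y p)) (res-res X Y G) ⟩
  consNE ((X ∩ Y) ∩ p) (res (X ∩ Y) G)     ≡⟨ res-∷ (X ∩ Y) p G ⟨
  res (X ∩ Y) (p ∷ G)                      ∎
  where open ≡-Reasoning

-- The product sees only the part of `G` inside the blocks of `F`. With `Z` the complement of a
-- first block this decouples the remaining blocks in `μ-·`.
·-res : (Z : Subset n) (F G : Face n) → All (_⊆ Z) F → F · res Z G ≡ F · G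
·-res Z []      G _ = refl
·-res Z (X ∷ F) G (s ∷ ss) = begin
  (X ∷ F) · res Z G              ≡⟨ ·-∷ X F (res Z G) ⟩
  res X (res Z G) ++ F · res Z G ≡⟨ cong₂ _++_ (trans (res-res X Z G) (cong (λ Y → res Y G) X∩Z)) (·-res Z F G ss) ⟩
  res X G ++ F · G               ≡⟨ ·-∷ X F G ⟨
  (X ∷ F) · G                    ∎
  where
  open ≡-Reasoning
  X∩Z : X ∩ Z ≡ X
  X∩Z = Subₚ.⊆-antisym (Subₚ.p∩q⊆p _ _) (λ i → Subₚ.x∈p∩q⁺ (i , s i))

-- Monotonicity of the knapsack number

module _ {a p q} {B : Set a} {P : B → Set p} {Q : B → Set q}
         (P? : ∀ x → Dec (P x)) (Q? : ∀ x → Dec (Q x)) (P⇒Q : ∀ {x} → P x → Q x) where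

  filter-mono : ∀ xs → length (filter P? xs) ≤ length (filter Q? xs)
  filter-mono [] = z≤n
  filter-mono (x ∷ xs) with P? x | Q? x
  ... | yes _  | yes _  = s≤s (filter-mono xs)
  ... | yes Px | no ¬Qx = ⊥-elim (¬Qx (P⇒Q Px))
  ... | no _   | yes _  = ℕₚ.m≤n⇒m≤1+n (filter-mono xs)
  ... | no _   | no _   = filter-mono xs

  filter-strict : ∀ {x xs} → x ∈ xs → Q x → ¬ P x → length (filter P? xs) < length (filter Q? xs)
  filter-strict {x} {xs = _ ∷ xs} (here refl) Qx ¬Px with P? x | Q? x
  ... | yes Px | _      = ⊥-elim (¬Px Px)
  ... | no _   | no ¬Qx = ⊥-elim (¬Qx Qx)
  ... | no _   | yes _  = s≤s (filter-mono xs)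
  filter-strict {xs = y ∷ xs} (there m) Qx ¬Px with P? y | Q? y
  ... | yes _  | yes _  = s≤s (filter-strict m Qx ¬Px)
  ... | yes Py | no ¬Qy = ⊥-elim (¬Qy (P⇒Q Py))
  ... | no _   | yes _  = ℕₚ.m≤n⇒m≤1+n (filter-strict m Qx ¬Px)
  ... | no _   | no _   = filter-strict m Qx ¬Px

knapsack-≤ : (α : List ℕ) (F : Face n) → knapsack α F ≤ length (faces n)
knapsack-≤ {n} α F = Listₚ.length-filter _ (faces n)

knapsack-· : (α : List ℕ) (F G : Face n) → knapsack α F ≤ knapsack α (F · G)
knapsack-· {n} α F G = filter-mono _ _ (λ { {K} (⪯K , t) → ⪯-trans (F · G) F K (·-⪯ˡ F G) ⪯K , t }) (faces n)

knapsack-·-< : (α : List ℕ) (F G : Face n) → G ∈ faces n → type G ≡ α → ¬ F ⪯ G →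
               knapsack α F < knapsack α (F · G)
knapsack-·-< {n} α F G m t ¬⪯ =
  filter-strict _ _ (λ { {K} (⪯K , t) → ⪯-trans (F · G) F K (·-⪯ˡ F G) ⪯K , t })
    {x = G} {xs = faces n} m (·-⪯ʳ F G , t) (¬⪯ ∘ proj₁)

-- Listing ordered splittings and set compositions

Pair : ℕ → Set
Pair n = Subset n × Subset n

bits : Bool → Bool → Pair n → Pair (suc n)
bits a b (p , q) = a ∷ p , b ∷ q

splits : Subset n → List (Pair n)
splits []          = ([] , []) ∷ []
splits (false ∷ A) = map (bits false false) (splits A)
splits (true ∷ A)  = map (bits true false) (splits A) ++ map (bits false true) (splits A)

-- The splittings with nonempty left part: once an element has gone left the later ones are free,
-- hence `splits` in the first summand.
splits⁺ : Subset n → List (Pair n)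
splits⁺ []          = []
splits⁺ (false ∷ A) = map (bits false false) (splits⁺ A)
splits⁺ (true ∷ A)  = map (bits true false) (splits A) ++ map (bits false true) (splits⁺ A)

splits-sound : (A : Subset n) {x : Pair n} → x ∈ splits A → Split A (proj₁ x) (proj₂ x)
splits-sound [] (here refl) = []
splits-sound (false ∷ A) m with ∈-map⁻ _ m
... | _ , m′ , refl = off (splits-sound A m′)
splits-sound (true ∷ A) m with ∈-++⁻ (map (bits true false) (splits A)) m
... | inj₁ m with ∈-map⁻ _ m
...   | _ , m′ , refl = left (splits-sound A m′)
splits-sound (true ∷ A) m | inj₂ m′ with ∈-map⁻ _ m′
...   | _ , m″ , refl = right (splits-sound A m″)

splits⁺-sound : (A : Subset n) {x : Pair n} → x ∈ splits⁺ A →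
                Split A (proj₁ x) (proj₂ x) × Nonempty (proj₁ x)
splits⁺-sound (false ∷ A) m with ∈-map⁻ _ m
... | _ , m′ , refl with splits⁺-sound A m′
...   | s , _ , i = off s , _ , there i
splits⁺-sound (true ∷ A) m with ∈-++⁻ (map (bits true false) (splits A)) m
... | inj₁ m with ∈-map⁻ _ m
...   | _ , m′ , refl = left (splits-sound A m′) , _ , here
splits⁺-sound (true ∷ A) m | inj₂ m′ with ∈-map⁻ _ m′
...   | _ , m″ , refl with splits⁺-sound A m″
...     | s , _ , i = right s , _ , there i

split-< : Split A p q → Nonempty p → ∣ q ∣ < ∣ A ∣
split-< {q = q} s x = subst (∣ q ∣ <_) (sym (split-size s)) (ℕₚ.m<n+m ∣ q ∣ (nonempty-size x))

-- Listing by first block exposes the recursion that the generate-and-filter list `faces` hides. The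
-- fuel `k` has to exceed the number of blocks; the filter admits the empty face only for empty `A`.
facesF : ℕ → Subset n → List (Face n)
facesF zero    A = []
facesF (suc k) A = filter (λ _ → A ≟ₛ ⊥) ([] ∷ [])
                ++ concatMap (λ { (p , q) → map (p ∷_) (facesF k q) }) (splits⁺ A)

-- Signed sums over set compositions

module FaceSums {c ℓ′} (𝕜 : Field c ℓ′) where
  open Field 𝕜 hiding (refl; sym; trans; zero)
  open OverField 𝕜
  open FieldSums 𝕜
  open import Relation.Binary.Reasoning.Setoid setoid
  open import Algebra.Properties.Ring ring using (-‿distribˡ-*; +-cancelʳ)
  open Enumerates

  sum-bits : (A : Subset n) (f : Pair (suc n) → Carrier) →
    sumOver (splits (true ∷ A)) f ≈ sumOver (splits A) (f ∘ bits true false) + sumOver (splits A) (f ∘ bits false true)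
  sum-bits A f = ≈-trans (sum-++ (map (bits true false) (splits A)) _ f)
    (+-cong (reflexive (sum-map _ (splits A) f)) (reflexive (sum-map _ (splits A) f)))

  sum-off : (A : Subset n) (f : Pair (suc n) → Carrier) →
    sumOver (splits (false ∷ A)) f ≈ sumOver (splits A) (f ∘ bits false false)
  sum-off A f = reflexive (sum-map _ (splits A) f)

  sum-splits⁺ : (A : Subset n) (f : Pair n → Carrier) →
    sumOver (splits A) f ≈ f (⊥ , A) + sumOver (splits⁺ A) f
  sum-splits⁺ []          f = ≈-refl
  sum-splits⁺ (false ∷ A) f = begin
    sumOver (splits (false ∷ A)) f                         ≈⟨ sum-off A f ⟩
    sumOver (splits A) (f ∘ bits false false)              ≈⟨ sum-splits⁺ A _ ⟩
    _ + sumOver (splits⁺ A) (f ∘ bits false false)         ≈⟨ +-congˡ (reflexive (sum-map _ (splits⁺ A) f)) ⟨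
    _ + sumOver (splits⁺ (false ∷ A)) f                    ∎
  sum-splits⁺ (true ∷ A)  f = begin
    sumOver (splits (true ∷ A)) f                          ≈⟨ sum-bits A f ⟩
    a + sumOver (splits A) (f ∘ bits false true)           ≈⟨ +-congˡ (sum-splits⁺ A _) ⟩
    a + (x + b)                                            ≈⟨ +-assoc _ _ _ ⟨
    a + x + b                                              ≈⟨ +-congʳ (+-comm _ _) ⟩
    x + a + b                                              ≈⟨ +-assoc _ _ _ ⟩
    x + (a + b)
      ≈⟨ +-congˡ (+-cong (reflexive (sum-map _ (splits A) f)) (reflexive (sum-map _ (splits⁺ A) f))) ⟨
    x + (sumOver (map (bits true false) (splits A)) f + sumOver (map (bits false true) (splits⁺ A)) f)
      ≈⟨ +-congˡ (sum-++ (map (bits true false) (splits A)) _ f) ⟨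
    x + sumOver (splits⁺ (true ∷ A)) f                     ∎
    where
    a = sumOver (splits A) (f ∘ bits true false)
    b = sumOver (splits⁺ A) (f ∘ bits false true)
    x = f (⊥ , true ∷ A)

  ∷≟∷ : ∀ (b : Bool) (p q : Subset n) → [ (b ∷ p) ≟ₛ (b ∷ q) ] ≈ [ p ≟ₛ q ]
  ∷≟∷ b p q = [⇔] ((b ∷ p) ≟ₛ (b ∷ q)) (p ≟ₛ q) (λ { refl → refl }) (cong (b ∷_))

  ∷≢∷ : ∀ {a b : Bool} → ¬ a ≡ b → (p q : Subset n) → [ (a ∷ p) ≟ₛ (b ∷ q) ] ≈ 0#
  ∷≢∷ {a = a} {b} a≢b p q = [no] ((a ∷ p) ≟ₛ (b ∷ q)) (λ { refl → a≢b refl })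

  private
    t≢f : ¬ true ≡ false
    t≢f ()
    f≢t : ¬ false ≡ true
    f≢t ()

  sift-splitsˡ : Split A p q → (f : Pair n → Carrier) →
                 sumOver (splits A) (λ x → [ p ≟ₛ proj₁ x ] * f x) ≈ f (p , q)
  sift-splitsˡ [] f = ≈-trans (+-identityʳ _) (*-identityˡ _)
  sift-splitsˡ (off {A = A} {p = p} s) f = begin
    _ ≈⟨ sum-off A _ ⟩
    _ ≈⟨ sum-cong (splits A) (λ x → *-congʳ (∷≟∷ false p (proj₁ x))) ⟩
    _ ≈⟨ sift-splitsˡ s (f ∘ bits false false) ⟩
    _ ∎
  sift-splitsˡ (left {A = A} {p = p} s) f = begin
    _ ≈⟨ sum-bits A _ ⟩
    _ ≈⟨ +-cong (sum-cong (splits A) (λ x → *-congʳ (∷≟∷ true p (proj₁ x))))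
                (sum-zero (splits A) (λ {x} _ → ≈-trans (*-congʳ (∷≢∷ t≢f p (proj₁ x))) (zeroˡ _))) ⟩
    _ ≈⟨ +-identityʳ _ ⟩
    _ ≈⟨ sift-splitsˡ s (f ∘ bits true false) ⟩
    _ ∎
  sift-splitsˡ (right {A = A} {p = p} s) f = begin
    _ ≈⟨ sum-bits A _ ⟩
    _ ≈⟨ +-cong (sum-zero (splits A) (λ {x} _ → ≈-trans (*-congʳ (∷≢∷ f≢t p (proj₁ x))) (zeroˡ _)))
                (sum-cong (splits A) (λ x → *-congʳ (∷≟∷ false p (proj₁ x)))) ⟩
    _ ≈⟨ +-identityˡ _ ⟩
    _ ≈⟨ sift-splitsˡ s (f ∘ bits false true) ⟩
    _ ∎

  sift-splits⁺ : Split A p q → Nonempty p → (f : Pair n → Carrier) →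
                 sumOver (splits⁺ A) (λ x → [ p ≟ₛ proj₁ x ] * f x) ≈ f (p , q)
  sift-splits⁺ {A = A} {p} {q} s ne f = begin
    sumOver (splits⁺ A) g                            ≈⟨ +-identityˡ _ ⟨
    0# + sumOver (splits⁺ A) g                       ≈⟨ +-congʳ ([no]* (p ≟ₛ ⊥) (λ { refl → ¬nonempty-⊥ ne }) _) ⟨
    g (⊥ , A) + sumOver (splits⁺ A) g                ≈⟨ sum-splits⁺ A g ⟨
    sumOver (splits A) g                             ≈⟨ sift-splitsˡ s f ⟩
    f (p , q)                                        ∎
    where g = λ x → [ p ≟ₛ proj₁ x ] * f x

  sum-splits-⊥ˡ : (A : Subset n) (f : Pair n → Carrier) →
                  sumOver (splits A) (λ x → [ proj₁ x ≟ₛ ⊥ ] * f x) ≈ f (⊥ , A)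
  sum-splits-⊥ˡ A f = ≈-trans
    (sum-cong (splits A) (λ x → *-congʳ ([⇔] (proj₁ x ≟ₛ ⊥) (⊥ ≟ₛ proj₁ x) sym sym)))
    (sift-splitsˡ (⊥-split A) f)

  sum-splits-⊥ʳ : (A : Subset n) (f : Pair n → Carrier) →
                  sumOver (splits A) (λ x → [ proj₂ x ≟ₛ ⊥ ] * f x) ≈ f (A , ⊥)
  sum-splits-⊥ʳ [] f = ≈-trans (+-identityʳ _) (*-identityˡ _)
  sum-splits-⊥ʳ (false ∷ A) f = begin
    _ ≈⟨ sum-off A _ ⟩
    _ ≈⟨ sum-cong (splits A) (λ x → *-congʳ (∷≟∷ false (proj₂ x) ⊥)) ⟩
    _ ≈⟨ sum-splits-⊥ʳ A (f ∘ bits false false) ⟩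
    _ ∎
  sum-splits-⊥ʳ (true ∷ A) f = begin
    _ ≈⟨ sum-bits A _ ⟩
    _ ≈⟨ +-cong (sum-cong (splits A) (λ x → *-congʳ (∷≟∷ false (proj₂ x) ⊥)))
                (sum-zero (splits A) (λ {x} _ → ≈-trans (*-congʳ (∷≢∷ t≢f (proj₂ x) ⊥)) (zeroˡ _))) ⟩
    _ ≈⟨ +-identityʳ _ ⟩
    _ ≈⟨ sum-splits-⊥ʳ A (f ∘ bits true false) ⟩
    _ ∎

  -- Both sides run over the ordered splittings of `A` into three parts; this is the associativity
  -- of the convolution.
  sum-splits-assoc : (A : Subset n) (f : Subset n → Subset n → Subset n → Carrier) →
    sumOver (splits A) (λ x → sumOver (splits (proj₁ x)) (λ y → f (proj₁ y) (proj₂ y) (proj₂ x))) ≈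
    sumOver (splits A) (λ x → sumOver (splits (proj₂ x)) (λ y → f (proj₁ x) (proj₁ y) (proj₂ y)))
  sum-splits-assoc [] f = ≈-refl
  sum-splits-assoc (false ∷ A) f = begin
    _ ≈⟨ sum-off A _ ⟩
    _ ≈⟨ sum-cong (splits A) (λ x → sum-off (proj₁ x) _) ⟩
    _ ≈⟨ sum-splits-assoc A _ ⟩
    _ ≈⟨ sum-cong (splits A) (λ x → sum-off (proj₂ x) _) ⟨
    _ ≈⟨ sum-off A _ ⟨
    _ ∎
  sum-splits-assoc (true ∷ A) f = begin
    _ ≈⟨ sum-bits A _ ⟩
    _ ≈⟨ +-cong (sum-cong (splits A) (λ x → sum-bits (proj₁ x) _)) (sum-cong (splits A) (λ x → sum-off (proj₁ x) _)) ⟩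
    _ ≈⟨ +-congʳ (sum-+ (splits A) _ _) ⟩
    _ ≈⟨ +-assoc _ _ _ ⟩
    -- One summand for each of the three parts that may receive the first element.
    _ ≈⟨ +-cong (sum-splits-assoc A (λ a b c → f (true ∷ a) (false ∷ b) (false ∷ c)))
                (+-cong (sum-splits-assoc A (λ a b c → f (false ∷ a) (true ∷ b) (false ∷ c)))
                        (sum-splits-assoc A (λ a b c → f (false ∷ a) (false ∷ b) (true ∷ c)))) ⟩
    _ ≈⟨ +-congˡ (sum-+ (splits A) _ _) ⟨
    _ ≈⟨ +-cong (sum-cong (splits A) (λ x → sum-off (proj₂ x) _)) (sum-cong (splits A) (λ x → sum-bits (proj₂ x) _)) ⟨
    _ ≈⟨ sum-bits A _ ⟨
    _ ∎

  -- Splitting `A` means splitting its parts inside and outside `Z` independently, since each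
  -- element of `A` is decided on exactly one side.
  sum-splits-∩ : (Z A : Subset n) (f : Pair n → Pair n → Carrier) →
    sumOver (splits A) (λ x → f (Z ∩ proj₁ x , Z ∩ proj₂ x) (∁ Z ∩ proj₁ x , ∁ Z ∩ proj₂ x)) ≈
    sumOver (splits (Z ∩ A)) (λ x → sumOver (splits (∁ Z ∩ A)) (f x))
  sum-splits-∩ [] [] f = ≈-sym (+-identityʳ _)
  sum-splits-∩ (true ∷ Z) (false ∷ A) f = begin
    _ ≈⟨ sum-off A _ ⟩
    _ ≈⟨ sum-splits-∩ Z A _ ⟩
    _ ≈⟨ sum-cong (splits (Z ∩ A)) (λ x → sum-off (∁ Z ∩ A) _) ⟨
    _ ≈⟨ sum-off (Z ∩ A) _ ⟨
    _ ∎
  sum-splits-∩ (false ∷ Z) (false ∷ A) f = begin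
    _ ≈⟨ sum-off A _ ⟩
    _ ≈⟨ sum-splits-∩ Z A _ ⟩
    _ ≈⟨ sum-cong (splits (Z ∩ A)) (λ x → sum-off (∁ Z ∩ A) _) ⟨
    _ ≈⟨ sum-off (Z ∩ A) _ ⟨
    _ ∎
  sum-splits-∩ (true ∷ Z) (true ∷ A) f = begin
    _ ≈⟨ sum-bits A _ ⟩
    _ ≈⟨ +-cong (sum-splits-∩ Z A _) (sum-splits-∩ Z A _) ⟩
    _ ≈⟨ +-cong (sum-cong (splits (Z ∩ A)) (λ x → sum-off (∁ Z ∩ A) _)) (sum-cong (splits (Z ∩ A)) (λ x → sum-off (∁ Z ∩ A) _)) ⟨
    _ ≈⟨ sum-bits (Z ∩ A) _ ⟨
    _ ∎
  sum-splits-∩ (false ∷ Z) (true ∷ A) f = begin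
    _ ≈⟨ sum-bits A _ ⟩
    _ ≈⟨ +-cong (sum-splits-∩ Z A _) (sum-splits-∩ Z A _) ⟩
    _ ≈⟨ sum-+ (splits (Z ∩ A)) _ _ ⟨
    _ ≈⟨ sum-cong (splits (Z ∩ A)) (λ x → sum-bits (∁ Z ∩ A) _) ⟨
    _ ≈⟨ sum-off (Z ∩ A) _ ⟨
    _ ∎

  sum-facesF : ∀ k (A : Subset n) (f : Face n → Carrier) →
    sumOver (facesF (suc k) A) f ≈
    [ A ≟ₛ ⊥ ] * f [] + sumOver (splits⁺ A) (λ x → sumOver (facesF k (proj₂ x)) (f ∘ (proj₁ x ∷_)))
  sum-facesF k A f = ≈-trans
    (sum-++ (filter (λ _ → A ≟ₛ ⊥) ([] ∷ [])) _ f)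
    (+-cong (≈-trans (sum-filter (λ _ → A ≟ₛ ⊥) ([] ∷ []) f) (+-identityʳ _))
            (≈-trans (sum-concatMap _ (splits⁺ A) f)
                     (sum-cong (splits⁺ A) (λ { (p , q) → reflexive (sum-map (p ∷_) (facesF k q) f) }))))

  facesF-sound : ∀ k (A : Subset n) {h} → h ∈ facesF k A → FaceOf A h
  facesF-sound (suc k) A m with ∈-++⁻ (filter (λ _ → A ≟ₛ ⊥) ([] ∷ [])) m
  ... | inj₁ m′ with ∈-filter⁻ (λ _ → A ≟ₛ ⊥) {xs = [] ∷ []} m′
  ...   | here refl , e = e
  facesF-sound (suc k) A m | inj₂ m′ with find (∈-concatMap⁻ _ {xs = splits⁺ A} m′)
  ... | (p , q) , pq∈ , h∈ with ∈-map⁻ (p ∷_) h∈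
  ...   | h , h∈′ , refl with splits⁺-sound A pq∈
  ...     | s , ne = ne , q , s , facesF-sound k q h∈′

  enum-facesF : ∀ k (A : Subset n) → ∣ A ∣ < k → Enumerates _≟F_ (FaceOf A) (facesF k A)
  enum-facesF k A _ .sound = facesF-sound k A
  enum-facesF (suc k) A _ .sift [] e φ = begin
    _ ≈⟨ sum-facesF k A _ ⟩
    _ ≈⟨ +-cong ([yes]* (A ≟ₛ ⊥) e _)
          (sum-zero (splits⁺ A) (λ {x} _ → sum-zero (facesF k (proj₂ x)) (λ {h} _ → [no]* ([] ≟F (proj₁ x ∷ h)) (λ ()) _))) ⟩
    _ ≈⟨ +-identityʳ _ ⟩
    _ ≈⟨ *-identityˡ _ ⟩
    φ [] ∎
  enum-facesF {n} (suc k) A (s≤s A≤k) .sift (p ∷ h) (ne , q , s , fh) φ = begin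
    _ ≈⟨ sum-facesF k A _ ⟩
    _ ≈⟨ +-congʳ (≈-trans (*-congˡ ([no]* ((p ∷ h) ≟F []) (λ ()) _)) (zeroʳ _)) ⟩
    _ ≈⟨ +-identityˡ _ ⟩
    sumOver (splits⁺ A) (λ x → sumOver (facesF k (proj₂ x)) (λ M → [ (p ∷ h) ≟F (proj₁ x ∷ M) ] * φ (proj₁ x ∷ M)))
      ≈⟨ sum-cong (splits⁺ A) (λ x → ≈-trans (sum-cong (facesF k (proj₂ x)) (λ M →
            ≈-trans (*-congʳ ([×] (p ≟ₛ proj₁ x) (h ≟F M) ((p ∷ h) ≟F (proj₁ x ∷ M)) (λ { refl refl → refl }) (λ { refl → refl , refl })))
                    (*-assoc _ _ _)))
            (sum-*ˡ (facesF k (proj₂ x)) _ _)) ⟩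
    sumOver (splits⁺ A) (λ x → [ p ≟ₛ proj₁ x ] * sumOver (facesF k (proj₂ x)) (λ M → [ h ≟F M ] * φ (proj₁ x ∷ M)))
      ≈⟨ sift-splits⁺ s ne _ ⟩
    sumOver (facesF k q) (λ M → [ h ≟F M ] * φ (p ∷ M))
      ≈⟨ enum-facesF k q (ℕₚ.<-≤-trans (split-< s ne) A≤k) .sift h fh (φ ∘ (p ∷_)) ⟩
    φ (p ∷ h) ∎

  enum-subsets : ∀ n → Enumerates _≟ₛ_ (λ _ → Unit) (allSubsets n)
  enum-subsets n .sound _ = tt
  enum-subsets zero .sift [] _ φ = ≈-trans (+-identityʳ _) (*-identityˡ _)
  enum-subsets (suc n) .sift (b ∷ p) _ φ = begin
    _ ≈⟨ sum-concatMap _ (allSubsets n) _ ⟩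
    sumOver (allSubsets n) (λ q → [ (b ∷ p) ≟ₛ (true ∷ q) ] * φ (true ∷ q) + ([ (b ∷ p) ≟ₛ (false ∷ q) ] * φ (false ∷ q) + 0#))
      ≈⟨ sum-cong (allSubsets n) (pick b) ⟩
    sumOver (allSubsets n) (λ q → [ p ≟ₛ q ] * φ (b ∷ q))
      ≈⟨ enum-subsets n .sift p tt (φ ∘ (b ∷_)) ⟩
    φ (b ∷ p) ∎
    where
    pick : ∀ b q → [ (b ∷ p) ≟ₛ (true ∷ q) ] * φ (true ∷ q) + ([ (b ∷ p) ≟ₛ (false ∷ q) ] * φ (false ∷ q) + 0#)
                   ≈ [ p ≟ₛ q ] * φ (b ∷ q)
    pick true q = begin
      _ ≈⟨ +-cong (*-congʳ (∷≟∷ true p q)) (≈-trans (+-identityʳ _) (≈-trans (*-congʳ (∷≢∷ t≢f p q)) (zeroˡ _))) ⟩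
      _ ≈⟨ +-identityʳ _ ⟩
      _ ∎
    pick false q = begin
      _ ≈⟨ +-cong (≈-trans (*-congʳ (∷≢∷ f≢t p q)) (zeroˡ _)) (≈-trans (+-identityʳ _) (*-congʳ (∷≟∷ false p q))) ⟩
      _ ≈⟨ +-identityˡ _ ⟩
      _ ∎

  enum-faces : ∀ n → Enumerates _≟F_ IsFace (faces n)
  enum-faces n = enum-lists _≟ₛ_ (enum-subsets n) isFace? (suc n)
    (λ L f → All.tabulate (λ _ → tt) , s≤s (isFace-length f))

  -- The fuel suc n suffices: a set composition of A has at most ∣ A ∣ ≤ n blocks.
  μ : Subset n → (Face n → Carrier) → Carrier
  μ {n} A φ = sumOver (facesF (suc n) A) (λ G → sign (length G) * φ G)

  enum-μ : (A : Subset n) → Enumerates _≟F_ (FaceOf A) (facesF (suc n) A)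
  enum-μ {n} A = enum-facesF (suc n) A (s≤s (Subₚ.∣p∣≤n A))

  μ-cong : (A : Subset n) {φ ψ : Face n → Carrier} → (∀ G → FaceOf A G → φ G ≈ ψ G) → μ A φ ≈ μ A ψ
  μ-cong {n} A e = sum-cong∈ (facesF (suc n) A) (λ {G} m → *-congˡ (e G (facesF-sound (suc n) A m)))

  μ-unfold : (A : Subset n) (φ : Face n → Carrier) →
    μ A φ ≈ [ A ≟ₛ ⊥ ] * φ [] + - sumOver (splits⁺ A) (λ x → μ (proj₂ x) (φ ∘ (proj₁ x ∷_)))
  μ-unfold {n} A φ = begin
    _ ≈⟨ sum-facesF n A _ ⟩
    _ ≈⟨ +-cong (*-congˡ (*-identityˡ _)) (sum-cong∈ (splits⁺ A) step) ⟩
    [ A ≟ₛ ⊥ ] * φ [] + sumOver (splits⁺ A) (λ x → - μ (proj₂ x) (φ ∘ (proj₁ x ∷_)))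
      ≈⟨ +-congˡ (sum-neg (splits⁺ A) _) ⟩
    _ ∎
    where
    step : ∀ {x} → x ∈ splits⁺ A → sumOver (facesF n (proj₂ x)) (λ G → - sign (length G) * φ (proj₁ x ∷ G))
                                   ≈ - μ (proj₂ x) (φ ∘ (proj₁ x ∷_))
    step {p , q} m with splits⁺-sound A m
    ... | s , ne = begin
      _ ≈⟨ sum-cong (facesF n q) (λ G → ≈-sym (-‿distribˡ-* _ _)) ⟩
      _ ≈⟨ sum-neg (facesF n q) _ ⟩
      -- The unfolding leaves fuel `n`, whereas `μ` has fuel `suc n`; both list the set compositions
      -- of `q`, because removing the nonempty `p` has lowered the size.
      _ ≈⟨ -‿cong (sum-enum _≟F_ (enum-facesF n q (ℕₚ.<-≤-trans (split-< s ne) (Subₚ.∣p∣≤n A))) (enum-μ q) _) ⟩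
      _ ∎

  -- μ is the convolution inverse of the operation of prepending one (possibly empty) block.
  μ-conv : (A : Subset n) (φ : Face n → Carrier) →
    sumOver (splits A) (λ x → μ (proj₂ x) (φ ∘ consNE (proj₁ x))) ≈ [ A ≟ₛ ⊥ ] * φ []
  μ-conv A φ = begin
    _ ≈⟨ sum-splits⁺ A _ ⟩
    μ A (φ ∘ consNE ⊥) + sumOver (splits⁺ A) (λ x → μ (proj₂ x) (φ ∘ consNE (proj₁ x)))
      ≈⟨ +-cong (μ-cong A (λ G _ → reflexive (cong φ (consNE-⊥ G))))
                (sum-cong∈ (splits⁺ A) (λ {x} m → μ-cong (proj₂ x) (λ G _ →
                   reflexive (cong φ (consNE-nonempty (proj₂ (splits⁺-sound A m)) G))))) ⟩
    -- Unfolding the term with empty left part by its first block produces exactly minus the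
    -- remaining sum `S`.
    μ A φ + S                          ≈⟨ +-congʳ (μ-unfold A φ) ⟩
    [ A ≟ₛ ⊥ ] * φ [] + - S + S        ≈⟨ +-assoc _ _ _ ⟩
    [ A ≟ₛ ⊥ ] * φ [] + (- S + S)      ≈⟨ +-congˡ (-‿inverseˡ S) ⟩
    [ A ≟ₛ ⊥ ] * φ [] + 0#             ≈⟨ +-identityʳ _ ⟩
    [ A ≟ₛ ⊥ ] * φ []                  ∎
    where S = sumOver (splits⁺ A) (λ x → μ (proj₂ x) (φ ∘ (proj₁ x ∷_)))

  sum-splits-⊥ : (f : Pair n → Carrier) → sumOver (splits ⊥) f ≈ f (⊥ , ⊥)
  sum-splits-⊥ {zero}  f = +-identityʳ _
  sum-splits-⊥ {suc n} f = ≈-trans (sum-off (⊥ {n}) f) (sum-splits-⊥ {n} (f ∘ bits false false))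

  μ-⊥ : (φ : Face n → Carrier) → μ ⊥ φ ≈ φ []
  μ-⊥ {n} φ = begin
    μ ⊥ φ                       ≈⟨ μ-cong ⊥ (λ G _ → reflexive (cong φ (consNE-⊥ G))) ⟨
    μ ⊥ (φ ∘ consNE ⊥)          ≈⟨ sum-splits-⊥ {n} (λ x → μ (proj₂ x) (φ ∘ consNE (proj₁ x))) ⟨
    sumOver (splits ⊥) (λ x → μ (proj₂ x) (φ ∘ consNE (proj₁ x))) ≈⟨ μ-conv ⊥ φ ⟩
    [ ⊥ {n} ≟ₛ ⊥ ] * φ []       ≈⟨ [yes]* (⊥ {n} ≟ₛ ⊥) refl _ ⟩
    φ []                        ∎

  μ-sum : ∀ {a} {B : Set a} (A : Subset n) (xs : List B) (f : B → Face n → Carrier) →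
    sumOver xs (λ x → μ A (f x)) ≈ μ A (λ G → sumOver xs (λ x → f x G))
  μ-sum {n} A xs f = ≈-trans (sum-swap xs (facesF (suc n) A) _)
    (sum-cong (facesF (suc n) A) (λ G → sum-*ˡ xs _ _))

  μ-*ˡ : (A : Subset n) (a : Carrier) (φ : Face n → Carrier) → μ A (λ G → a * φ G) ≈ a * μ A φ
  μ-*ˡ {n} A a φ = ≈-trans
    (sum-cong (facesF (suc n) A) (λ G → ≈-trans (≈-sym (*-assoc _ _ _)) (≈-trans (*-congʳ (*-comm _ _)) (*-assoc _ _ _))))
    (sum-*ˡ (facesF (suc n) A) a _)

  μ-swap : (A B : Subset n) (φ : Face n → Face n → Carrier) →
    μ A (λ G → μ B (φ G)) ≈ μ B (λ H → μ A (λ G → φ G H))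
  μ-swap {n} A B φ = ≈-trans
    (sum-cong (facesF (suc n) A) (λ G → ≈-sym (μ-*ˡ B (sign (length G)) (φ G))))
    (μ-sum B (facesF (suc n) A) _)

  -- Both sides satisfy the recursion that determines μ.
  μ-restrict : (Z : Subset n) → ∀ m (A : Subset n) → ∣ A ∣ < m → (φ : Face n → Face n → Carrier) →
    μ A (λ G → φ (res Z G) (res (∁ Z) G)) ≈ μ (Z ∩ A) (λ h → μ (∁ Z ∩ A) (φ h))
  μ-restrict {n} Z (suc m) A (s≤s A≤m) φ =
    -- `L` and `R` are the two sides with a block prepended. Their convolution sums agree, and
    -- induction identifies all terms with nonempty first block; cancelling `rest` leaves the terms
    -- with empty first block, which are the claim.
    ≈-trans (≈-sym (L-⊥ A)) (≈-trans (+-cancelʳ rest _ _ (begin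
      L A ⊥ + rest
        ≈⟨ +-congˡ (sum-cong∈ (splits⁺ A) (λ {x} i →
             μ-restrict Z m (proj₂ x) (let s , ne = splits⁺-sound A i in ℕₚ.<-≤-trans (split-< s ne) A≤m) _)) ⟨
      L A ⊥ + sumOver (splits⁺ A) (λ x → L (proj₂ x) (proj₁ x))
        ≈⟨ sum-splits⁺ A _ ⟨
      sumOver (splits A) (λ x → L (proj₂ x) (proj₁ x))
        ≈⟨ sum-cong (splits A) (λ x → μ-cong (proj₂ x) (λ G _ →
             reflexive (cong₂ φ (sym (res-consNE Z (proj₁ x) G)) (sym (res-consNE (∁ Z) (proj₁ x) G))))) ⟩
      sumOver (splits A) (λ x → μ (proj₂ x) ((λ G → φ (res Z G) (res (∁ Z) G)) ∘ consNE (proj₁ x)))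
        ≈⟨ μ-conv A (λ G → φ (res Z G) (res (∁ Z) G)) ⟩
      [ A ≟ₛ ⊥ ] * φ [] []
        -- `A` is empty exactly when both parts are, so the unit of the convolution factors, and
        -- each factor is expanded again on its own side.
        ≈⟨ *-congʳ ([×] ((Z ∩ A) ≟ₛ ⊥) ((∁ Z ∩ A) ≟ₛ ⊥) (A ≟ₛ ⊥) empty-parts (λ { refl → Subₚ.∩-zeroʳ Z , Subₚ.∩-zeroʳ (∁ Z) })) ⟩
      ([ (Z ∩ A) ≟ₛ ⊥ ] * [ (∁ Z ∩ A) ≟ₛ ⊥ ]) * φ [] []
        ≈⟨ *-assoc _ _ _ ⟩
      [ (Z ∩ A) ≟ₛ ⊥ ] * ([ (∁ Z ∩ A) ≟ₛ ⊥ ] * φ [] [])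
        ≈⟨ μ-conv (Z ∩ A) (λ h → [ (∁ Z ∩ A) ≟ₛ ⊥ ] * φ h []) ⟨
      sumOver (splits (Z ∩ A)) (λ x → μ (proj₂ x) (λ h → [ (∁ Z ∩ A) ≟ₛ ⊥ ] * φ (consNE (proj₁ x) h) []))
        ≈⟨ sum-cong (splits (Z ∩ A)) (λ x → ≈-trans
             (μ-sum (proj₂ x) (splits (∁ Z ∩ A)) _)
             (μ-cong (proj₂ x) (λ h _ → μ-conv (∁ Z ∩ A) (φ (consNE (proj₁ x) h))))) ⟨
      sumOver (splits (Z ∩ A)) (λ x → sumOver (splits (∁ Z ∩ A)) (λ y →
        μ (proj₂ x) (λ h → μ (proj₂ y) (λ g → φ (consNE (proj₁ x) h) (consNE (proj₁ y) g)))))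
        ≈⟨ sum-splits-∩ Z A _ ⟨
      sumOver (splits A) (λ x → R (proj₂ x) (proj₁ x))
        ≈⟨ sum-splits⁺ A _ ⟩
      R A ⊥ + rest ∎)) (R-⊥ A))
    where
    L R : Subset n → Subset n → Carrier
    L q p = μ q (λ G → φ (consNE (Z ∩ p) (res Z G)) (consNE (∁ Z ∩ p) (res (∁ Z) G)))
    R q p = μ (Z ∩ q) (λ h → μ (∁ Z ∩ q) (λ g → φ (consNE (Z ∩ p) h) (consNE (∁ Z ∩ p) g)))
    rest = sumOver (splits⁺ A) (λ x → R (proj₂ x) (proj₁ x))
    consNE-∩⊥ : ∀ (Y : Subset n) h → consNE (Y ∩ ⊥) h ≡ h
    consNE-∩⊥ Y h = trans (cong (λ p → consNE p h) (Subₚ.∩-zeroʳ Y)) (consNE-⊥ h)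
    L-⊥ : ∀ q → L q ⊥ ≈ μ q (λ G → φ (res Z G) (res (∁ Z) G))
    L-⊥ q = μ-cong q (λ G _ → reflexive (cong₂ φ (consNE-∩⊥ Z _) (consNE-∩⊥ (∁ Z) _)))
    R-⊥ : ∀ q → R q ⊥ ≈ μ (Z ∩ q) (λ h → μ (∁ Z ∩ q) (φ h))
    R-⊥ q = μ-cong (Z ∩ q) (λ h _ → μ-cong (∁ Z ∩ q) (λ g _ → reflexive (cong₂ φ (consNE-∩⊥ Z h) (consNE-∩⊥ (∁ Z) g))))
    empty-parts : Z ∩ A ≡ ⊥ → ∁ Z ∩ A ≡ ⊥ → A ≡ ⊥
    empty-parts e e′ = empty⇒⊥ λ { (i , i∈A) → case (Subₚ._∈?_ i Z) i∈A }
      where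
      case : ∀ {i} → Dec (i ∈ₛ Z) → ¬ i ∈ₛ A
      case (yes i∈Z) i∈A = Subₚ.∉⊥ (subst (_ ∈ₛ_) e (Subₚ.x∈p∩q⁺ (i∈Z , i∈A)))
      case (no i∉Z)  i∈A = Subₚ.∉⊥ (subst (_ ∈ₛ_) e′ (Subₚ.x∈p∩q⁺ (Subₚ.x∉p⇒x∈∁p i∉Z , i∈A)))

-- Signed sums over the refinements of a face

consNE-++ : (p : Subset n) (h k : Face n) → consNE p h ++ k ≡ consNE p (h ++ k)
consNE-++ p h k with does (nonempty? p)
... | true  = refl
... | false = refl

split-∩ˡ : Split A p q → p ∩ A ≡ p
split-∩ˡ {p = p} s = Subₚ.⊆-antisym (Subₚ.p∩q⊆p _ _)
  (λ i → Subₚ.x∈p∩q⁺ (i , subst (_ ∈ₛ_) (split-∪ s) (Subₚ.p⊆p∪q _ i)))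

split-⊆∁ : Split A p q → q ⊆ ∁ p
split-⊆∁ s i = Subₚ.x∉p⇒x∈∁p (λ j → split-disjoint s j i)

split-∁∩ : Split A p q → ∁ p ∩ A ≡ q
split-∁∩ {A = A} {p = p} {q = q} s = Subₚ.⊆-antisym
  (λ i → to (Subₚ.x∈p∩q⁻ (∁ p) A i))
  (λ i → Subₚ.x∈p∩q⁺ (split-⊆∁ s i , subst (_ ∈ₛ_) (split-∪ s) (Subₚ.q⊆p∪q _ _ i)))
  where
  to : ∀ {i} → i ∈ₛ ∁ p × i ∈ₛ A → i ∈ₛ q
  to (i∉p , i∈A) with Subₚ.x∈p∪q⁻ p q (subst (_ ∈ₛ_) (sym (split-∪ s)) i∈A)
  ... | inj₁ i∈p = ⊥-elim (Subₚ.x∈∁p⇒x∉p i∉p i∈p)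
  ... | inj₂ i∈q = i∈q

faceOf-cases : {h : Face n} → Nonempty X → FaceOf X h → X ∷ [] ≡ h ⊎ 1 < length h
faceOf-cases {h = []} ne refl = ⊥-elim (¬nonempty-⊥ ne)
faceOf-cases {h = Y ∷ []} ne (_ , _ , s , refl) = inj₁ (cong (_∷ []) (split-⊥ʳ s))
faceOf-cases {h = Y ∷ Z ∷ h} _ _ = inj₂ (s≤s (s≤s z≤n))

faceOf-pos : {h : Face n} → Nonempty X → FaceOf X h → 0 < length h
faceOf-pos ne f with faceOf-cases ne f
... | inj₁ refl = z<s
... | inj₂ lt   = ℕₚ.<⇒≤ lt

module Refinements {c ℓ′} (𝕜 : Field c ℓ′) where
  open Field 𝕜 hiding (refl; sym; trans; zero)
  open OverField 𝕜
  open FieldSums 𝕜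
  open FaceSums 𝕜
  open import Relation.Binary.Reasoning.Setoid setoid
  open import Algebra.Properties.Ring ring using (-‿distribˡ-*)
  open Enumerates

  -- The sum over all H obtained from `F` by replacing every block with a set composition of it,
  -- weighted by (-1)^ℓ(H). Up to the factor `sign n` it is the transpose of right multiplication by
  -- w̃₀.
  refSum : Face n → (Face n → Carrier) → Carrier
  refSum []      φ = φ []
  refSum (X ∷ F) φ = μ X (λ h → refSum F (φ ∘ (h ++_)))

  refSum-cong : (F : Face n) {φ ψ : Face n → Carrier} → (∀ H → φ H ≈ ψ H) → refSum F φ ≈ refSum F ψ
  refSum-cong []      e = e []
  refSum-cong (X ∷ F) e = μ-cong X (λ h _ → refSum-cong F (λ H → e (h ++ H)))

  refSum-cong-face : {A : Subset n} (F : Face n) {φ ψ : Face n → Carrier} → FaceOf A F →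
    (∀ H → FaceOf A H → length F ≤ length H → φ H ≈ ψ H) → refSum F φ ≈ refSum F ψ
  refSum-cong-face []      f e = e [] f z≤n
  refSum-cong-face (X ∷ F) (ne , q , s , f) e = μ-cong X (λ h fh → refSum-cong-face F f
    (λ H fH le → e (h ++ H) (faceOf-++ {h = h} s fh fH)
       (subst (suc (length F) ≤_) (sym (Listₚ.length-++ h)) (ℕₚ.+-mono-≤ (faceOf-pos ne fh) le))))

  refSum-++ : (F G : Face n) (φ : Face n → Carrier) →
    refSum (F ++ G) φ ≈ refSum F (λ a → refSum G (λ b → φ (a ++ b)))
  refSum-++ []      G φ = ≈-refl
  refSum-++ (X ∷ F) G φ = μ-cong X (λ h _ → ≈-trans (refSum-++ F G (φ ∘ (h ++_)))
    (refSum-cong F (λ a → refSum-cong G (λ b → reflexive (cong φ (sym (Listₚ.++-assoc h a b)))))))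

  refSum-μ : (F : Face n) (A : Subset n) (φ : Face n → Face n → Carrier) →
    μ A (λ G → refSum F (φ G)) ≈ refSum F (λ H → μ A (λ G → φ G H))
  refSum-μ []      A φ = ≈-refl
  refSum-μ (X ∷ F) A φ = ≈-trans (μ-swap A X _) (μ-cong X (λ h _ → refSum-μ F A (λ G → φ G ∘ (h ++_))))

  refSum-swap : (F G : Face n) (φ : Face n → Face n → Carrier) →
    refSum F (λ H → refSum G (φ H)) ≈ refSum G (λ K → refSum F (λ H → φ H K))
  refSum-swap []      G φ = ≈-refl
  refSum-swap (X ∷ F) G φ = ≈-trans
    (μ-cong X (λ h _ → refSum-swap F G (φ ∘ (h ++_))))
    (refSum-μ G X (λ h K → refSum F (λ H → φ (h ++ H) K)))

  refSum-consNE : (p : Subset n) (h : Face n) (ψ : Face n → Carrier) →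
    refSum (consNE p h) ψ ≈ μ p (λ k → refSum h (ψ ∘ (k ++_)))
  refSum-consNE {n} p h ψ with nonempty? p
  ... | yes _ = ≈-refl
  ... | no ¬x rewrite empty⇒⊥ ¬x = ≈-sym (μ-⊥ {n} (λ k → refSum h (ψ ∘ (k ++_))))

  -- With ζ p = consNE p, this evaluates (ζ * μ) * u = ζ * (μ * u) in the convolution algebra.
  μ-refSum : (X : Subset n) (ψ : Face n → Carrier) → μ X (λ h → refSum h ψ) ≈ ψ (consNE X [])
  μ-refSum {n} X ψ = begin
    u X ψ
      ≈⟨ sum-splits-⊥ˡ X (λ x → u (proj₂ x) ψ) ⟨
    sumOver (splits X) (λ x → [ proj₁ x ≟ₛ ⊥ ] * u (proj₂ x) ψ)
      ≈⟨ sum-cong (splits X) (λ x → μ-conv (proj₁ x) (λ k → u (proj₂ x) (ψ ∘ (k ++_)))) ⟨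
    sumOver (splits X) (λ x → sumOver (splits (proj₁ x)) (λ y →
      μ (proj₂ y) (λ k → u (proj₂ x) (ψ ∘ (consNE (proj₁ y) k ++_)))))
      ≈⟨ sum-splits-assoc X (λ p r s → μ r (λ k → u s (ψ ∘ (consNE p k ++_)))) ⟩
    sumOver (splits X) (λ x → sumOver (splits (proj₂ x)) (λ y →
      μ (proj₁ y) (λ k → u (proj₂ y) (ψ ∘ (consNE (proj₁ x) k ++_)))))
      ≈⟨ sum-cong (splits X) (λ x → sum-cong (splits (proj₂ x)) (λ y →
           μ-cong (proj₁ y) (λ k _ → u-cong (proj₂ y) (λ g → reflexive (cong ψ (consNE-++ (proj₁ x) k g)))))) ⟩
    sumOver (splits X) (λ x → sumOver (splits (proj₂ x)) (λ y →
      μ (proj₁ y) (λ k → u (proj₂ y) (ψ ∘ consNE (proj₁ x) ∘ (k ++_)))))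
      ≈⟨ sum-cong (splits X) (λ x → u-conv (proj₂ x) (ψ ∘ consNE (proj₁ x))) ⟩
    sumOver (splits X) (λ x → [ proj₂ x ≟ₛ ⊥ ] * ψ (consNE (proj₁ x) []))
      ≈⟨ sum-splits-⊥ʳ X (λ x → ψ (consNE (proj₁ x) [])) ⟩
    ψ (consNE X []) ∎
    where
    u : Subset n → (Face n → Carrier) → Carrier
    u X ψ = μ X (λ h → refSum h ψ)
    u-cong : ∀ X {φ ψ : Face n → Carrier} → (∀ H → φ H ≈ ψ H) → u X φ ≈ u X ψ
    u-cong X e = μ-cong X (λ h _ → refSum-cong h e)
    -- `μ * u` is the unit: `refSum-consNE` absorbs the outer `μ` into a prepended block, and then
    -- `μ-conv` applies.
    u-conv : ∀ X ψ → sumOver (splits X) (λ y → μ (proj₁ y) (λ k → u (proj₂ y) (ψ ∘ (k ++_)))) ≈ [ X ≟ₛ ⊥ ] * ψ []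
    u-conv X ψ = begin
      _ ≈⟨ sum-cong (splits X) (λ y → μ-swap (proj₁ y) (proj₂ y) _) ⟩
      sumOver (splits X) (λ y → μ (proj₂ y) (λ h → μ (proj₁ y) (λ k → refSum h (ψ ∘ (k ++_)))))
        ≈⟨ sum-cong (splits X) (λ y → μ-cong (proj₂ y) (λ h _ → refSum-consNE (proj₁ y) h ψ)) ⟨
      sumOver (splits X) (λ y → μ (proj₂ y) ((λ h → refSum h ψ) ∘ consNE (proj₁ y)))
        ≈⟨ μ-conv X (λ h → refSum h ψ) ⟩
      [ X ≟ₛ ⊥ ] * ψ [] ∎

  -- Refining a refinement works block by block. Exchanging the sums brings both refinements of the
  -- first block together, where `μ-refSum` collapses them; nonemptiness ensures that `consNE` keeps
  -- the block.
  refSum-involutive : (F : Face n) → All Nonempty F → (φ : Face n → Carrier) →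
    refSum F (λ H → refSum H φ) ≈ φ F
  refSum-involutive []      _        φ = ≈-refl
  refSum-involutive (X ∷ F) (x ∷ xs) φ = begin
    μ X (λ h → refSum F (λ H → refSum (h ++ H) φ))
      ≈⟨ μ-cong X (λ h _ → refSum-cong F (λ H → refSum-++ h H φ)) ⟩
    μ X (λ h → refSum F (λ H → refSum h (λ a → refSum H (λ b → φ (a ++ b)))))
      ≈⟨ μ-cong X (λ h _ → refSum-swap F h _) ⟩
    μ X (λ h → refSum h (λ a → refSum F (λ H → refSum H (λ b → φ (a ++ b)))))
      ≈⟨ μ-cong X (λ h _ → refSum-cong h (λ a → refSum-involutive F xs (φ ∘ (a ++_)))) ⟩
    μ X (λ h → refSum h (λ a → φ (a ++ F)))
      ≈⟨ μ-refSum X (λ a → φ (a ++ F)) ⟩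
    φ (consNE X [] ++ F)
      ≈⟨ reflexive (cong (λ h → φ (h ++ F)) (consNE-nonempty x [])) ⟩
    φ (X ∷ F) ∎

  -- `(X ∷ F) · G` depends on `G` only through its restrictions to `X` and to the complement of `X`,
  -- and `μ-restrict` makes these independent.
  μ-· : {A : Subset n} (F : Face n) → FaceOf A F → (φ : Face n → Carrier) →
        μ A (λ G → φ (F · G)) ≈ refSum F φ
  μ-· {n} []  refl            φ = μ-⊥ {n} (λ _ → φ [])
  μ-· {n} {A} (X ∷ F) (x , q , s , f) φ = begin
    μ A (λ G → φ ((X ∷ F) · G))
      ≈⟨ μ-cong A (λ G _ → reflexive (cong φ (trans (·-∷ X F G) (cong (res X G ++_)
           (sym (·-res (∁ X) F G (All.tabulate (λ m i → split-⊆∁ s (faceOf-∈ f m i))))))))) ⟩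
    μ A (λ G → φ (res X G ++ F · res (∁ X) G))
      ≈⟨ μ-restrict X (suc ∣ A ∣) A ℕₚ.≤-refl (λ h g → φ (h ++ F · g)) ⟩
    μ (X ∩ A) (λ h → μ (∁ X ∩ A) (λ g → φ (h ++ F · g)))
      ≈⟨ reflexive (cong₂ (λ Y Z → μ Y (λ h → μ Z (λ g → φ (h ++ F · g)))) (split-∩ˡ s) (split-∁∩ s)) ⟩
    μ X (λ h → μ q (λ g → φ (h ++ F · g)))
      ≈⟨ μ-cong X (λ h _ → μ-· F f (φ ∘ (h ++_))) ⟩
    refSum (X ∷ F) φ ∎

  μ-single : (X : Subset n) → Nonempty X → (ψ : Face n → Carrier) →
    (∀ h → FaceOf X h → 1 < length h → ψ h ≈ 0#) → μ X ψ ≈ - ψ (X ∷ [])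
  μ-single {n} X ne ψ z = begin
    μ X ψ
      ≈⟨ sum-cong∈ (facesF (suc n) X) (λ {G} m → pick G (enum-μ X .sound m)) ⟩
    sumOver (facesF (suc n) X) (λ G → [ (X ∷ []) ≟F G ] * (sign (length G) * ψ G))
      ≈⟨ enum-μ X .sift (X ∷ []) (ne , ⊥ , subst (λ Y → Split Y X ⊥) (Subₚ.∪-identityʳ X)
            (disjoint-split X ⊥ (λ { (i , i∈) → Subₚ.∉⊥ (proj₂ (Subₚ.x∈p∩q⁻ X ⊥ i∈)) })) , refl) _ ⟩
    - 1# * ψ (X ∷ [])
      ≈⟨ -‿distribˡ-* _ _ ⟨
    - (1# * ψ (X ∷ []))
      ≈⟨ -‿cong (*-identityˡ _) ⟩
    - ψ (X ∷ []) ∎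
    where
    pick : ∀ G → FaceOf X G → sign (length G) * ψ G ≈ [ (X ∷ []) ≟F G ] * (sign (length G) * ψ G)
    pick G f with faceOf-cases ne f
    ... | inj₁ e  = ≈-sym ([yes]* ((X ∷ []) ≟F G) e _)
    ... | inj₂ lt = begin
      sign (length G) * ψ G ≈⟨ *-congˡ (z G f lt) ⟩
      sign (length G) * 0#  ≈⟨ zeroʳ _ ⟩
      0#                    ≈⟨ zeroʳ _ ⟨
      _ * 0#                ≈⟨ *-congˡ (zeroʳ _) ⟨
      _ * (_ * 0#)          ≈⟨ *-congˡ (*-congˡ (z G f lt)) ⟨
      [ (X ∷ []) ≟F G ] * (sign (length G) * ψ G) ∎

  refSum-zero : {A : Subset n} (F : Face n) {φ : Face n → Carrier} → FaceOf A F →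
    (∀ H → FaceOf A H → length F ≤ length H → φ H ≈ 0#) → refSum F φ ≈ 0#
  refSum-zero []      f e = e [] f z≤n
  refSum-zero {n} (X ∷ F) (ne , q , s , f) e = sum-zero (facesF (suc n) X) (λ {h} m →
    let fh = enum-μ X .sound m in
    ≈-trans (*-congˡ (refSum-zero F f (λ H fH le → e (h ++ H) (faceOf-++ {h = h} s fh fH)
       (subst (suc (length F) ≤_) (sym (Listₚ.length-++ h)) (ℕₚ.+-mono-≤ (faceOf-pos ne fh) le))))) (zeroʳ _))

  -- Any refinement other than `F` has more blocks, where `φ` vanishes; in the surviving term each
  -- block contributes one factor -1.
  refSum-diagonal : {A : Subset n} (F : Face n) {φ : Face n → Carrier} → FaceOf A F →
    (∀ H → FaceOf A H → length F < length H → φ H ≈ 0#) → refSum F φ ≈ sign (length F) * φ F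
  refSum-diagonal [] f z = ≈-sym (*-identityˡ _)
  refSum-diagonal (X ∷ F) {φ} (ne , q , s , f) z = begin
    μ X (λ h → refSum F (φ ∘ (h ++_)))
      ≈⟨ μ-single X ne _ (λ h fh lt → refSum-zero F f (λ H fH le → z (h ++ H) (faceOf-++ {h = h} s fh fH)
           (subst (suc (length F) <_) (sym (Listₚ.length-++ h)) (ℕₚ.+-mono-≤ lt le)))) ⟩
    - refSum F (φ ∘ (X ∷_))
      ≈⟨ -‿cong (refSum-diagonal F f (λ H fH lt → z (X ∷ H) (ne , q , s , fH) (s<s lt))) ⟩
    - (sign (length F) * φ (X ∷ F))
      ≈⟨ -‿distribˡ-* _ _ ⟩
    - sign (length F) * φ (X ∷ F) ∎

  refSum-*ˡ : (F : Face n) (a : Carrier) (φ : Face n → Carrier) → refSum F (λ H → a * φ H) ≈ a * refSum F φ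
  refSum-*ˡ []      a φ = ≈-refl
  refSum-*ˡ (X ∷ F) a φ = ≈-trans (μ-cong X (λ h _ → refSum-*ˡ F a (φ ∘ (h ++_)))) (μ-*ˡ X a _)

-- Diagonalising a triangular operator by Lagrange interpolation

module LinearAlgebra {c ℓ′} (𝕜 : Field c ℓ′) where
  open Field 𝕜 hiding (refl; sym; trans; zero)
  open OverField 𝕜
  open FieldSums 𝕜
  open FaceSums 𝕜
  open import Relation.Binary.Reasoning.Setoid setoid
  open import Algebra.Properties.Ring ring using (-‿distribˡ-*; -‿+-comm; x∙y⁻¹≈ε⇒x≈y; x[y-z]≈xy-xz; [y-z]x≈yx-zx)
  open import Algebra.Properties.CommutativeSemigroup +-commutativeSemigroup using () renaming (interchange to +-interchange)
  open import Algebra.Properties.CommutativeSemigroup *-commutativeSemigroup using (x∙yz≈y∙xz)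
  open Enumerates

  -- The functional that reads off the coefficient of `H`. For a transposed operator `A`,
  -- `A (δ H) F` is the coefficient of `H` in the image of `F`.
  δ : Face n → KΣ n
  δ H F = [ F ≟F H ]

  record IsLinear {n} (O : KΣ n → KΣ n) : Set (c Level.⊔ ℓ′) where
    field
      op-cong : ∀ {φ ψ} → φ ≈ᵥ ψ → O φ ≈ᵥ O ψ
      op-+    : ∀ φ ψ → O (φ +ᵥ ψ) ≈ᵥ (O φ +ᵥ O ψ)
      op-•    : ∀ a φ → O (a • φ) ≈ᵥ (a • O φ)

    op-0 : O 0ᵥ ≈ᵥ 0ᵥ
    op-0 F f = begin
      O 0ᵥ F           ≈⟨ op-cong (λ H _ → ≈-sym (zeroˡ 0#)) F f ⟩
      O (0# • 0ᵥ) F    ≈⟨ op-• 0# 0ᵥ F f ⟩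
      0# * O 0ᵥ F      ≈⟨ zeroˡ _ ⟩
      0#               ∎

    op-sum : ∀ {a} {B : Set a} (xs : List B) (φ : B → KΣ n) →
      O (λ H → sumOver xs (λ x → φ x H)) ≈ᵥ (λ H → sumOver xs (λ x → O (φ x) H))
    op-sum []       φ F f = op-0 F f
    op-sum (x ∷ xs) φ F f = ≈-trans (op-+ (φ x) _ F f) (+-congˡ (op-sum xs φ F f))

    op-expand : ∀ ψ F → IsFace F → O ψ F ≈ sumOver (faces n) (λ H → ψ H * O (δ H) F)
    op-expand ψ F f = begin
      O ψ F
        ≈⟨ op-cong (λ H h → ≈-sym (enum-faces n .sift H h ψ)) F f ⟩
      O (λ H → sumOver (faces n) (λ K → [ H ≟F K ] * ψ K)) F
        ≈⟨ op-cong (λ H _ → sum-cong (faces n) (λ K → *-comm _ _)) F f ⟩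
      O (λ H → sumOver (faces n) (λ K → (ψ K • δ K) H)) F
        ≈⟨ op-sum (faces n) _ F f ⟩
      sumOver (faces n) (λ K → O (ψ K • δ K) F)
        ≈⟨ sum-cong (faces n) (λ K → op-• (ψ K) (δ K) F f) ⟩
      sumOver (faces n) (λ H → ψ H * O (δ H) F) ∎

  open IsLinear

  ∘-linear : {O P : KΣ n → KΣ n} → IsLinear O → IsLinear P → IsLinear (O ∘ P)
  ∘-linear o p .op-cong e = op-cong o (op-cong p e)
  ∘-linear o p .op-+ φ ψ F f = ≈-trans (op-cong o (op-+ p φ ψ) F f) (op-+ o _ _ F f)
  ∘-linear o p .op-• a φ F f = ≈-trans (op-cong o (op-• p a φ) F f) (op-• o a _ F f)

  -- Interpolation divides by differences of roots, and equality in the field is not assumed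
  -- decidable, so distinctness carries the inverse.
  Apart : Carrier → Carrier → Set (c Level.⊔ ℓ′)
  Apart x y = Σ Carrier λ z → (x - y) * z ≈ 1#

  module Shifts {n} (A : KΣ n → KΣ n) (A-lin : IsLinear A) where

    shift : Carrier → KΣ n → KΣ n
    shift k φ F = A φ F - k * φ F

    prodOp : List Carrier → KΣ n → KΣ n
    prodOp []       φ = φ
    prodOp (k ∷ ks) φ = shift k (prodOp ks φ)

    shift-linear : ∀ k → IsLinear (shift k)
    shift-linear k .op-cong e F f = +-cong (op-cong A-lin e F f) (-‿cong (*-congˡ (e F f)))
    shift-linear k .op-+ φ ψ F f = begin
      A (φ +ᵥ ψ) F - k * (φ F + ψ F)
        ≈⟨ +-cong (op-+ A-lin φ ψ F f) (≈-trans (-‿cong (distribˡ k _ _)) (≈-sym (-‿+-comm _ _))) ⟩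
      (A φ F + A ψ F) + (- (k * φ F) + - (k * ψ F))
        ≈⟨ +-interchange _ _ _ _ ⟩
      shift k φ F + shift k ψ F ∎
    shift-linear k .op-• a φ F f = begin
      A (a • φ) F - k * (a * φ F)
        ≈⟨ +-cong (op-• A-lin a φ F f) (-‿cong (x∙yz≈y∙xz k a (φ F))) ⟩
      a * A φ F - a * (k * φ F)
        ≈⟨ x[y-z]≈xy-xz a _ _ ⟨
      a * shift k φ F ∎

    prodOp-linear : ∀ ks → IsLinear (prodOp ks)
    prodOp-linear [] .op-cong e = e
    prodOp-linear [] .op-+ φ ψ F f = ≈-refl
    prodOp-linear [] .op-• a φ F f = ≈-refl
    prodOp-linear (k ∷ ks) = ∘-linear (shift-linear k) (prodOp-linear ks)

    A-shift : ∀ k φ → A (shift k φ) ≈ᵥ shift k (A φ)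
    A-shift k φ F f = begin
      A (shift k φ) F
        ≈⟨ op-cong A-lin (λ H _ → +-congˡ (-‿distribˡ-* k (φ H))) F f ⟩
      A (A φ +ᵥ ((- k) • φ)) F
        ≈⟨ op-+ A-lin _ _ F f ⟩
      A (A φ) F + A ((- k) • φ) F
        ≈⟨ +-congˡ (op-• A-lin (- k) φ F f) ⟩
      A (A φ) F + - k * A φ F
        ≈⟨ +-congˡ (-‿distribˡ-* k _) ⟨
      shift k (A φ) F ∎

    A-prodOp : ∀ ks φ → A (prodOp ks φ) ≈ᵥ prodOp ks (A φ)
    A-prodOp []       φ F f = ≈-refl
    A-prodOp (k ∷ ks) φ F f = ≈-trans (A-shift k (prodOp ks φ) F f)
      (op-cong (shift-linear k) (A-prodOp ks φ) F f)

    shift-prodOp : ∀ k ks φ → shift k (prodOp ks φ) ≈ᵥ prodOp ks (shift k φ)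
    shift-prodOp k ks φ F f = begin
      A (prodOp ks φ) F - k * prodOp ks φ F
        ≈⟨ +-cong (A-prodOp ks φ F f) (≈-trans (-‿distribˡ-* k _) (≈-sym (op-• (prodOp-linear ks) (- k) φ F f))) ⟩
      prodOp ks (A φ) F + prodOp ks ((- k) • φ) F
        ≈⟨ op-+ (prodOp-linear ks) _ _ F f ⟨
      prodOp ks (A φ +ᵥ ((- k) • φ)) F
        ≈⟨ op-cong (prodOp-linear ks) (λ H _ → +-congˡ (≈-sym (-‿distribˡ-* k (φ H)))) F f ⟩
      prodOp ks (shift k φ) F ∎

    prodOp-++ : ∀ ks ls φ → prodOp (ks ++ ls) φ ≡ prodOp ks (prodOp ls φ)
    prodOp-++ []       ls φ = refl
    prodOp-++ (k ∷ ks) ls φ = cong (shift k) (prodOp-++ ks ls φ)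

    -- Polynomials in `A` commute, so a root can be moved out of any position of the list.
    prodOp-pull : ∀ ks k ls φ → prodOp (ks ++ k ∷ ls) φ ≈ᵥ shift k (prodOp (ks ++ ls) φ)
    prodOp-pull ks k ls φ F f = begin
      prodOp (ks ++ k ∷ ls) φ F           ≈⟨ reflexive (cong (λ ψ → ψ F) (prodOp-++ ks (k ∷ ls) φ)) ⟩
      prodOp ks (shift k (prodOp ls φ)) F ≈⟨ shift-prodOp k ks (prodOp ls φ) F f ⟨
      shift k (prodOp ks (prodOp ls φ)) F ≈⟨ reflexive (cong (λ ψ → shift k ψ F) (prodOp-++ ks ls φ)) ⟨
      shift k (prodOp (ks ++ ls) φ) F     ∎

  -- `T` is the transpose of `A`. The conclusion of `A-triangular` also covers faces longer than
  -- `r`, where `φ` and hence `A φ` vanish, so the property passes to polynomials in `A`. Equal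
  -- eigenvalues at different faces are harmless: `locate` finds the value once in `spectrum`, apart
  -- from all other entries.
  module Diagonalization {n} (A : KΣ n → KΣ n) (A-lin : IsLinear A)
    (T : KΣ n → KΣ n)
    (T≈ : ∀ x H → IsFace H → T x H ≈ sumOver (faces n) (λ F → x F * A (δ H) F))
    (eig : Face n → Carrier)
    (A-triangular : ∀ r φ → (∀ F → IsFace F → r < length F → φ F ≈ 0#) →
                    ∀ F → IsFace F → r ≤ length F → A φ F ≈ eig F * φ F)
    (spectrum : List Carrier)
    (annihilates : ∀ φ → Shifts.prodOp A A-lin spectrum φ ≈ᵥ 0ᵥ)
    (locate : ∀ F → Σ (List Carrier) λ ks → Σ Carrier λ k → Σ (List Carrier) λ ls →
              spectrum ≡ ks ++ k ∷ ls × eig F ≈ k × All (Apart (eig F)) (ks ++ ls))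
    where
    open Shifts A A-lin

    diffs : Carrier → List Carrier → Carrier
    diffs x []       = 1#
    diffs x (k ∷ ks) = (x - k) * diffs x ks

    diffs-inverse : ∀ {x ks} → All (Apart x) ks → Σ Carrier λ z → z * diffs x ks ≈ 1#
    diffs-inverse [] = 1# , *-identityˡ 1#
    diffs-inverse {x} {k ∷ ks} ((y , e) ∷ as) with diffs-inverse as
    ... | z , e′ = y * z , (begin
      (y * z) * ((x - k) * diffs x ks)   ≈⟨ *-assoc _ _ _ ⟩
      y * (z * ((x - k) * diffs x ks))   ≈⟨ *-congˡ (x∙yz≈y∙xz _ _ _) ⟩
      y * ((x - k) * (z * diffs x ks))   ≈⟨ *-congˡ (≈-trans (*-congˡ e′) (*-identityʳ _)) ⟩
      y * (x - k)                        ≈⟨ ≈-trans (*-comm _ _) e ⟩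
      1#                                 ∎)

    prodOp-triangular : ∀ ks r φ → (∀ F → IsFace F → r < length F → φ F ≈ 0#) →
      ∀ F → IsFace F → r ≤ length F → prodOp ks φ F ≈ diffs (eig F) ks * φ F
    prodOp-triangular []       r φ z F f le = ≈-sym (*-identityˡ _)
    prodOp-triangular (k ∷ ks) r φ z F f le = begin
      A ψ F - k * ψ F                      ≈⟨ +-congʳ (A-triangular r ψ ψ-zero F f le) ⟩
      eig F * ψ F - k * ψ F                ≈⟨ [y-z]x≈yx-zx (ψ F) _ _ ⟨
      (eig F - k) * ψ F                    ≈⟨ *-congˡ (prodOp-triangular ks r φ z F f le) ⟩
      (eig F - k) * (diffs (eig F) ks * φ F)   ≈⟨ *-assoc _ _ _ ⟨
      diffs (eig F) (k ∷ ks) * φ F         ∎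
      where
      ψ = prodOp ks φ
      ψ-zero : ∀ F → IsFace F → r < length F → ψ F ≈ 0#
      ψ-zero F f lt = ≈-trans (prodOp-triangular ks r φ z F f (ℕₚ.<⇒≤ lt))
                              (≈-trans (*-congˡ (z F f lt)) (zeroʳ _))

    others : Face n → List Carrier
    others F = let ks , _ , ls , _ = locate F in ks ++ ls

    scale : Face n → Carrier
    scale F = let _ , _ , _ , _ , _ , as = locate F in proj₁ (diffs-inverse as)

    -- The Lagrange interpolation polynomial of A at eig F, applied to F.
    v : Face n → KΣ n
    v F H = scale F * prodOp (others F) (δ H) F

    -- `δ H` vanishes on all faces longer than `H`, so the interpolation polynomial acts at `F` by
    -- its value at `eig F`, which `scale` normalises to 1. Hence `v F` is `F` plus longer faces.
    v-unitriangular : ∀ F → IsFace F → ∀ H → length H ≤ length F → v F H ≈ [ F ≟F H ]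
    v-unitriangular F f H le = begin
      scale F * prodOp (others F) (δ H) F
        ≈⟨ *-congˡ (prodOp-triangular (others F) (length H) (δ H)
             (λ K _ lt → [no] (K ≟F H) (λ { refl → ℕₚ.<-irrefl refl lt })) F f le) ⟩
      scale F * (diffs (eig F) (others F) * δ H F)
        ≈⟨ *-assoc _ _ _ ⟨
      (scale F * diffs (eig F) (others F)) * δ H F
        ≈⟨ *-congʳ (let _ , _ , _ , _ , _ , as = locate F in proj₂ (diffs-inverse as)) ⟩
      1# * δ H F
        ≈⟨ *-identityˡ _ ⟩
      [ F ≟F H ] ∎

    -- The missing factor at `eig F` completes the Lagrange polynomial to the annihilating one.
    prodOp-eigen : ∀ F → IsFace F → ∀ H → A (prodOp (others F) (δ H)) F ≈ eig F * prodOp (others F) (δ H) F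
    prodOp-eigen F f H with locate F
    ... | ks , k , ls , e , eig≈k , _ = ≈-trans
      (x∙y⁻¹≈ε⇒x≈y _ _ (≈-trans (≈-sym (prodOp-pull ks k ls (δ H) F f))
        (≈-trans (reflexive (cong (λ L → prodOp L (δ H) F) (sym e))) (annihilates (δ H) F f))))
      (*-congʳ (≈-sym eig≈k))

    v-eigen : ∀ F → IsFace F → T (v F) ≈ᵥ (eig F • v F)
    v-eigen F f H h = begin
      T (v F) H
        ≈⟨ T≈ (v F) H h ⟩
      sumOver (faces n) (λ K → (scale F * P (δ K) F) * A (δ H) K)
        ≈⟨ sum-cong (faces n) (λ K → ≈-trans (*-assoc _ _ _) (*-congˡ (*-comm _ _))) ⟩
      sumOver (faces n) (λ K → scale F * (A (δ H) K * P (δ K) F))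
        ≈⟨ sum-*ˡ (faces n) (scale F) _ ⟩
      scale F * sumOver (faces n) (λ K → A (δ H) K * P (δ K) F)
        ≈⟨ *-congˡ (op-expand (prodOp-linear (others F)) (A (δ H)) F f) ⟨
      scale F * P (A (δ H)) F
        ≈⟨ *-congˡ (A-prodOp (others F) (δ H) F f) ⟨
      scale F * A (P (δ H)) F
        ≈⟨ *-congˡ (prodOp-eigen F f H) ⟩
      scale F * (eig F * P (δ H) F)
        ≈⟨ x∙yz≈y∙xz _ _ _ ⟩
      eig F * v F H ∎
      where P = prodOp (others F)

    -- The coefficient of `F` in the combination receives only `co F` and contributions of shorter
    -- faces, whose coefficients vanish by induction on the length bound `m`.
    independent : (co : Face n → Carrier) → lincomb co v ≈ᵥ 0ᵥ → ∀ m F → IsFace F → length F < m → co F ≈ 0#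
    independent co z (suc m) F f (s≤s F≤m) = begin
      co F
        ≈⟨ enum-faces n .sift F f co ⟨
      sumOver (faces n) (λ K → [ F ≟F K ] * co K)
        ≈⟨ sum-cong∈ (faces n) (λ {K} i → term K (enum-faces n .sound i)) ⟨
      lincomb co v F
        ≈⟨ z F f ⟩
      0# ∎
      where
      term : ∀ K → IsFace K → co K * v K F ≈ [ F ≟F K ] * co K
      term K k with length F ℕ.≤? length K
      ... | yes le = ≈-trans (*-congˡ (≈-trans (v-unitriangular K k F le) ([⇔] (K ≟F F) (F ≟F K) sym sym))) (*-comm _ _)
      ... | no ¬le = ≈-trans
        (≈-trans (*-congʳ (independent co z m K k (ℕₚ.<-≤-trans (ℕₚ.≰⇒> ¬le) F≤m))) (zeroˡ _))
        (≈-sym ([no]* (F ≟F K) (λ { refl → ¬le ℕₚ.≤-refl }) _))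

    -- Unitriangular solving from short faces to long ones: adding the error at length `r` to the
    -- coefficients of those faces corrects it and leaves shorter faces unaffected.
    spanning : (x : KΣ n) → ∀ r → Σ (Face n → Carrier) λ co → ∀ H → IsFace H → length H < r → x H ≈ lincomb co v H
    spanning x zero    = (λ _ → 0#) , λ _ _ ()
    spanning x (suc r) with spanning x r
    ... | co , e = co′ , e′
      where
      defect : Face n → Carrier
      defect F = [ length F ℕ.≟ r ] * (x F - lincomb co v F)
      co′ : Face n → Carrier
      co′ F = co F + defect F
      lincomb-co′ : ∀ H → lincomb co′ v H ≈ lincomb co v H + sumOver (faces n) (λ F → defect F * v F H)
      lincomb-co′ H = ≈-trans (sum-cong (faces n) (λ F → distribʳ (v F H) (co F) (defect F))) (sum-+ (faces n) _ _)
      defect-v : ∀ H → IsFace H → length H ≤ r → ∀ F → IsFace F → defect F * v F H ≈ [ H ≟F F ] * defect F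
      defect-v H h le F f with length F ℕ.≟ r
      ... | yes refl = ≈-trans (*-congˡ (≈-trans (v-unitriangular F f H le) ([⇔] (F ≟F H) (H ≟F F) sym sym))) (*-comm _ _)
      ... | no F≢r = ≈-trans (*-congʳ zero-defect) (≈-trans (zeroˡ _) (≈-sym (≈-trans (*-congˡ zero-defect) (zeroʳ _))))
        where zero-defect = [no]* (length F ℕ.≟ r) F≢r (x F - lincomb co v F)
      value : ∀ H → IsFace H → length H ≤ r → lincomb co′ v H ≈ lincomb co v H + defect H
      value H h le = ≈-trans (lincomb-co′ H) (+-congˡ (≈-trans
        (sum-cong∈ (faces n) (λ {F} i → defect-v H h le F (enum-faces n .sound i)))
        (enum-faces n .sift H h defect)))
      e′ : ∀ H → IsFace H → length H < suc r → x H ≈ lincomb co′ v H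
      e′ H h (s≤s le) with ℕₚ.m≤n⇒m<n∨m≡n le
      ... | inj₁ lt = ≈-trans (e H h lt) (≈-sym (≈-trans (value H h le)
              (≈-trans (+-congˡ ([no]* (length H ℕ.≟ r) (ℕₚ.<⇒≢ lt) _)) (+-identityʳ _))))
      ... | inj₂ eq = ≈-sym (begin
        lincomb co′ v H                               ≈⟨ value H h le ⟩
        y + defect H                                  ≈⟨ +-congˡ ([yes]* (length H ℕ.≟ r) eq _) ⟩
        y + (x H - y)                                 ≈⟨ +-congˡ (+-comm _ _) ⟩
        y + (- y + x H)                               ≈⟨ +-assoc _ _ _ ⟨
        y + - y + x H                                 ≈⟨ +-congʳ (-‿inverseʳ _) ⟩
        0# + x H                                      ≈⟨ +-identityˡ _ ⟩
        x H                                           ∎)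
        where y = lincomb co v H

    eigenbasis : HasEigenbasis n T eig
    eigenbasis = v , v-eigen , (λ co z F f → independent co z (suc (length F)) F f ℕₚ.≤-refl) ,
      -- A face has at most `n` blocks, so stage `suc n` reaches all of them.
      λ x → let co , e = spanning x (suc n) in co , λ H h → e H h (s≤s (isFace-length h))

-- Right multiplication by w̃₀ and by B̃_α

module Operators {c ℓ′} (𝕜 : Field c ℓ′) where
  open Field 𝕜 hiding (refl; sym; trans; zero)
  open OverField 𝕜
  open FieldSums 𝕜
  open FaceSums 𝕜
  open Refinements 𝕜
  open LinearAlgebra 𝕜
  open import Relation.Binary.Reasoning.Setoid setoid
  open import Algebra.Properties.Ring ring using (-‿distribˡ-*; -‿distribʳ-*; -0#≈0#; -‿+-comm; x≈y⇒x∙y⁻¹≈ε; -‿involutive)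
  open import Algebra.Properties.CommutativeSemigroup *-commutativeSemigroup using (x∙yz≈y∙xz)
  open Enumerates
  open IsLinear

  -x*-y≈x*y : ∀ x y → - x * - y ≈ x * y
  -x*-y≈x*y x y = begin
    - x * - y     ≈⟨ -‿distribˡ-* x (- y) ⟨
    - (x * - y)   ≈⟨ -‿cong (-‿distribʳ-* x y) ⟨
    - - (x * y)   ≈⟨ -‿involutive _ ⟩
    x * y         ∎

  sign-∸ : ∀ {l m} → l ≤ m → sign (m ∸ l) ≈ sign m * sign l
  sign-∸ z≤n       = ≈-sym (*-identityʳ _)
  sign-∸ (s≤s l≤m) = ≈-trans (sign-∸ l≤m) (≈-sym (-x*-y≈x*y _ _))

  sign² : ∀ m → sign m * sign m ≈ 1#
  sign² zero    = *-identityˡ 1#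
  sign² (suc m) = ≈-trans (-x*-y≈x*y _ _) (sign² m)

  sign-cases : ∀ m → sign m ≈ 1# ⊎ sign m ≈ - 1#
  sign-cases zero    = inj₁ ≈-refl
  sign-cases (suc m) with sign-cases m
  ... | inj₁ e = inj₂ (-‿cong e)
  ... | inj₂ e = inj₁ (≈-trans (-‿cong e) (-‿involutive 1#))

  -- The transpose of right multiplication by y.
  R : KΣ n → KΣ n → KΣ n
  R {n} y φ F = sumOver (faces n) (λ G → y G * φ (F · G))

  R-cong-at : (y φ ψ : KΣ n) (F : Face n) →
    (∀ G → IsFace G → φ (F · G) ≈ ψ (F · G)) → R y φ F ≈ R y ψ F
  R-cong-at {n} y φ ψ F e = sum-cong∈ (faces n) (λ {G} i → *-congˡ (e G (enum-faces n .sound i)))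

  R-linear : (y : KΣ n) → IsLinear (R y)
  R-linear y .op-cong {φ} {ψ} e F f = R-cong-at y φ ψ F (λ G g → e (F · G) (isFace-· f g))
  R-linear {n} y .op-+ φ ψ F f = ≈-trans (sum-cong (faces n) (λ G → distribˡ _ _ _)) (sum-+ (faces n) _ _)
  R-linear {n} y .op-• a φ F f = ≈-trans (sum-cong (faces n) (λ G → x∙yz≈y∙xz _ _ _)) (sum-*ˡ (faces n) a _)

  ⋆-R : (x y : KΣ n) (H : Face n) → (x ⋆ y) H ≈ sumOver (faces n) (λ F → x F * R y (δ H) F)
  ⋆-R {n} x y H = sum-cong (faces n) (λ F → ≈-trans
    (sum-cong (faces n) (λ G → ≈-trans (*-comm _ _) (*-assoc _ _ _)))
    (sum-*ˡ (faces n) (x F) _))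

  -- Right multiplication by `y` and `R y` are adjoint for the pairing of vectors with functions;
  -- expanding `ψ` in deltas reduces this to `⋆-R`.
  ⋆-pairing : (x y ψ : KΣ n) →
    sumOver (faces n) (λ H → (x ⋆ y) H * ψ H) ≈ sumOver (faces n) (λ F → x F * R y ψ F)
  ⋆-pairing {n} x y ψ = begin
    sumOver Φ (λ H → (x ⋆ y) H * ψ H)
      ≈⟨ sum-cong Φ (λ H → ≈-trans (*-congʳ (⋆-R x y H)) (≈-sym (sum-*ʳ Φ _ _))) ⟩
    sumOver Φ (λ H → sumOver Φ (λ F → (x F * R y (δ H) F) * ψ H))
      ≈⟨ sum-swap Φ Φ _ ⟩
    sumOver Φ (λ F → sumOver Φ (λ H → (x F * R y (δ H) F) * ψ H))
      ≈⟨ sum-cong Φ (λ F → ≈-trans (sum-cong Φ (λ H → ≈-trans (*-assoc _ _ _) (*-congˡ (*-comm _ _)))) (sum-*ˡ Φ _ _)) ⟩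
    sumOver Φ (λ F → x F * sumOver Φ (λ H → ψ H * R y (δ H) F))
      ≈⟨ sum-cong∈ Φ (λ {F} i → *-congˡ (op-expand (R-linear y) ψ F (enum-faces n .sound i))) ⟨
    sumOver Φ (λ F → x F * R y ψ F) ∎
    where Φ = faces n

  -- Transposition reverses the order: the last multiplication, by `z`, acts first on `δ H`.
  ⋆⋆-R : (x y z : KΣ n) (H : Face n) →
    ((x ⋆ y) ⋆ z) H ≈ sumOver (faces n) (λ F → x F * R y (R z (δ H)) F)
  ⋆⋆-R x y z H = ≈-trans (⋆-R (x ⋆ y) z H) (⋆-pairing x y (R z (δ H)))

  enum-faces⊤ : ∀ n → Enumerates _≟F_ (FaceOf ⊤) (faces n)
  enum-faces⊤ n .sound i     = isFace⇒faceOf (enum-faces n .sound i)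
  enum-faces⊤ n .sift H h    = enum-faces n .sift H (faceOf⇒isFace h)

  module _ {n} (W : KΣ n) (W-sign : ∀ G → IsFace G → W G ≈ sign (n ∸ length G)) where

    -- The sign (-1)^(n-ℓ(G)) differs from the sign inside `μ` by the constant `sign n`; the rest is
    -- `μ-·` for the whole set.
    RW-refSum : ∀ φ F → IsFace F → R W φ F ≈ sign n * refSum F φ
    RW-refSum φ F f = begin
      R W φ F
        ≈⟨ sum-cong∈ (faces n) (λ {G} i → let g = enum-faces n .sound i in
             ≈-trans (*-congʳ (≈-trans (W-sign G g) (sign-∸ (isFace-length g)))) (*-assoc _ _ _)) ⟩
      sumOver (faces n) (λ G → sign n * (sign (length G) * φ (F · G)))
        ≈⟨ sum-*ˡ (faces n) _ _ ⟩
      sign n * sumOver (faces n) (λ G → sign (length G) * φ (F · G))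
        ≈⟨ *-congˡ (sum-enum _≟F_ (enum-faces⊤ n) (enum-μ ⊤) _) ⟩
      sign n * μ ⊤ (λ G → φ (F · G))
        ≈⟨ *-congˡ (μ-· F (isFace⇒faceOf f) φ) ⟩
      sign n * refSum F φ ∎

    RW-involutive : ∀ φ F → IsFace F → R W (R W φ) F ≈ φ F
    RW-involutive φ F f = begin
      R W (R W φ) F
        ≈⟨ RW-refSum (R W φ) F f ⟩
      sign n * refSum F (R W φ)
        ≈⟨ *-congˡ (refSum-cong-face F (isFace⇒faceOf f) (λ H h _ → RW-refSum φ H (faceOf⇒isFace h))) ⟩
      sign n * refSum F (λ H → sign n * refSum H φ)
        ≈⟨ *-congˡ (refSum-*ˡ F (sign n) _) ⟩
      sign n * (sign n * refSum F (λ H → refSum H φ))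
        ≈⟨ *-assoc _ _ _ ⟨
      (sign n * sign n) * refSum F (λ H → refSum H φ)
        ≈⟨ *-cong (sign² n) (refSum-involutive F (proj₁ f) φ) ⟩
      1# * φ F
        ≈⟨ *-identityˡ _ ⟩
      φ F ∎

    RW-diagonal : ∀ φ F → IsFace F → (∀ H → IsFace H → length F < length H → φ H ≈ 0#) →
      R W φ F ≈ sign (n ∸ length F) * φ F
    RW-diagonal φ F f z = begin
      R W φ F
        ≈⟨ RW-refSum φ F f ⟩
      sign n * refSum F φ
        ≈⟨ *-congˡ (refSum-diagonal F (isFace⇒faceOf f) (λ H h → z H (faceOf⇒isFace h))) ⟩
      sign n * (sign (length F) * φ F)
        ≈⟨ *-assoc _ _ _ ⟨
      (sign n * sign (length F)) * φ F
        ≈⟨ *-congʳ (sign-∸ (isFace-length f)) ⟨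
      sign (n ∸ length F) * φ F ∎

  -- Faces `G` above `F` fix `F`, and the hypothesis removes the others. It is kept abstract because
  -- it is met in two ways: by the number of blocks in `RWB-triangular`, by the knapsack number in
  -- `RB-top`.
  RB-diagonal : (α : List ℕ) (φ : KΣ n) (F : Face n) → IsFace F →
    (∀ G → G ∈ faces n → type G ≡ α → ¬ F ⪯ G → φ (F · G) ≈ 0#) →
    R (B̃ α) φ F ≈ fromℕ (knapsack α F) * φ F
  RB-diagonal {n} α φ F f z = begin
    R (B̃ α) φ F
      ≈⟨ sum-cong∈ (faces n) (λ {G} i → term G i (F ⪯? G)) ⟩
    sumOver (faces n) (λ G → [ (F ⪯? G) ×-dec (type? G) ] * φ F)
      ≈⟨ sum-filter (λ G → (F ⪯? G) ×-dec (type? G)) (faces n) _ ⟨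
    sumOver (filter (λ G → (F ⪯? G) ×-dec (type? G)) (faces n)) (λ _ → φ F)
      ≈⟨ sum-const (filter (λ G → (F ⪯? G) ×-dec (type? G)) (faces n)) (φ F) ⟩
    fromℕ (knapsack α F) * φ F ∎
    where
    type? : (G : Face n) → Dec (type G ≡ α)
    type? G = Listₚ.≡-dec ℕ._≟_ (type G) α
    term : ∀ G → G ∈ faces n → Dec (F ⪯ G) →
           [ type? G ] * φ (F · G) ≈ [ (F ⪯? G) ×-dec (type? G) ] * φ F
    term G i (yes le) = *-cong ([⇔] (type? G) ((F ⪯? G) ×-dec (type? G)) (λ t → le , t) proj₂)
      (reflexive (cong φ (⪯⇒·≡ (isFace⇒faceOf f) (enum-faces n .sound i) le)))
    term G i (no ¬le) = ≈-trans
      (≈-trans ([ type? G ]*-cong (λ t → z G i t ¬le)) (zeroʳ _))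
      (≈-sym ([no]* ((F ⪯? G) ×-dec (type? G)) (¬le ∘ proj₁) _))

  -- Separation of the possible eigenvalues

  fromℕ-+ : ∀ a b → fromℕ (a ℕ.+ b) ≈ fromℕ a + fromℕ b
  fromℕ-+ zero    b = ≈-sym (+-identityˡ _)
  fromℕ-+ (suc a) b = ≈-trans (+-congˡ (fromℕ-+ a b)) (≈-sym (+-assoc _ _ _))

  -- The roots of the product of X² - m² over `k` ≤ m < `k + r`.
  signedFrom : ℕ → ℕ → List Carrier
  signedFrom k zero    = []
  signedFrom k (suc r) = fromℕ k ∷ - fromℕ k ∷ signedFrom (suc k) r

  apart-cong : ∀ {x x′ y y′} → x ≈ x′ → y ≈ y′ → Apart x y → Apart x′ y′
  apart-cong e e′ (z , p) = z , ≈-trans (*-congʳ (≈-sym (+-cong e (-‿cong e′)))) p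

  apart-neg : ∀ {x y} → Apart x y → Apart (- x) (- y)
  apart-neg {x} {y} (z , p) = - z , (begin
    (- x + - - y) * - z     ≈⟨ *-congʳ (-‿+-comm x (- y)) ⟩
    - (x - y) * - z         ≈⟨ -x*-y≈x*y _ _ ⟩
    (x - y) * z             ≈⟨ p ⟩
    1#                      ∎)

  apart-sym : ∀ {x y} → Apart x y → Apart y x
  apart-sym {x} {y} (z , p) = - z , (begin
    (y - x) * - z           ≈⟨ *-congʳ (+-congʳ (-‿involutive y)) ⟨
    (- - y - x) * - z       ≈⟨ *-congʳ (≈-trans (+-comm _ _) (-‿+-comm x (- y))) ⟩
    - (x - y) * - z         ≈⟨ -x*-y≈x*y _ _ ⟩
    (x - y) * z             ≈⟨ p ⟩
    1#                      ∎)

  module _ (char0 : CharZero) where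

    -- Characteristic 0 enters here: every difference between two entries of the spectrum is, up to
    -- sign, a positive integer.
    apart-+ : ∀ x m → Apart (fromℕ (suc m) + x) x
    apart-+ x m = let z , p = inverse (fromℕ (suc m)) (char0 m) in
      z , ≈-trans (*-congʳ (≈-trans (+-assoc _ _ _) (≈-trans (+-congˡ (-‿inverseʳ x)) (+-identityʳ _)))) p

    apart-< : ∀ {a b} → a < b → Apart (fromℕ b) (fromℕ a)
    apart-< {a} {b} a<b with ℕₚ.m≤n⇒∃[o]m+o≡n a<b
    ... | m , refl = apart-cong
      (≈-trans (≈-sym (fromℕ-+ (suc m) a)) (reflexive (cong (λ k → fromℕ (suc k)) (ℕₚ.+-comm m a)))) ≈-refl
      (apart-+ (fromℕ a) m)

    apart-pos-neg : ∀ a b → 0 < a → Apart (fromℕ a) (- fromℕ b)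
    apart-pos-neg (suc a) b _ = apart-cong
      (≈-trans (+-congʳ (fromℕ-+ (suc a) b)) (≈-trans (+-assoc _ _ _) (≈-trans (+-congˡ (-‿inverseʳ _)) (+-identityʳ _)))) ≈-refl
      (apart-+ (- fromℕ b) (a ℕ.+ b))

    signedFrom-apart : ∀ {x} k r → (∀ m → k ≤ m → Apart x (fromℕ m) × Apart x (- fromℕ m)) →
      All (Apart x) (signedFrom k r)
    signedFrom-apart k zero    h = []
    signedFrom-apart k (suc r) h =
      proj₁ (h k ℕₚ.≤-refl) ∷ proj₂ (h k ℕₚ.≤-refl) ∷ signedFrom-apart (suc k) r (λ m le → h m (ℕₚ.<⇒≤ le))

    Located : Carrier → List Carrier → Set (c Level.⊔ ℓ′)
    Located x L = Σ (List Carrier) λ ks → Σ Carrier λ k → Σ (List Carrier) λ ls →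
      L ≡ ks ++ k ∷ ls × x ≈ k × All (Apart x) (ks ++ ls)

    located-∷ : ∀ {x y L} → Apart x y → Located x L → Located x (y ∷ L)
    located-∷ {y = y} a (ks , k , ls , e , x≈k , as) = y ∷ ks , k , ls , cong (y ∷_) e , x≈k , a ∷ as

    -- The list is searched upwards. A pair ±k with k < N may be skipped because N - k and N + k are
    -- positive.
    locate-signed : ∀ k r N → 0 < k → k ≤ N → N < k ℕ.+ r →
      Located (fromℕ N) (signedFrom k r) × Located (- fromℕ N) (signedFrom k r)
    locate-signed k zero N 0<k k≤N N<k =
      ⊥-elim (ℕₚ.<⇒≱ N<k (subst (_≤ N) (sym (ℕₚ.+-identityʳ k)) k≤N))
    locate-signed k (suc r) N 0<k k≤N N< with ℕₚ.m≤n⇒m<n∨m≡n k≤N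
    ... | inj₂ refl =
        ([] , fromℕ k , _ , refl , ≈-refl , apart-pos-neg k k 0<k ∷ signedFrom-apart (suc k) r
           (λ m lt → apart-sym (apart-< lt) , apart-pos-neg k m 0<k))
      , (fromℕ k ∷ [] , - fromℕ k , _ , refl , ≈-refl , apart-sym (apart-pos-neg k k 0<k) ∷ signedFrom-apart (suc k) r
           (λ m lt → apart-sym (apart-pos-neg m k (ℕₚ.<-trans 0<k lt)) , apart-neg (apart-sym (apart-< lt))))
    ... | inj₁ k<N with locate-signed (suc k) r N z<s k<N (subst (N <_) (ℕₚ.+-suc k r) N<)
    ...   | pos , neg =
        located-∷ (apart-< k<N) (located-∷ (apart-pos-neg N k 0<N) pos)
      , located-∷ (apart-sym (apart-pos-neg k N 0<k)) (located-∷ (apart-neg (apart-< k<N)) neg)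
      where 0<N = ℕₚ.<-trans 0<k k<N

    -- 0 stands alone: starting `signedFrom` at 0 would list it twice, as 0 and as -0, and the root
    -- would not be simple.
    spectrumUpTo : ℕ → List Carrier
    spectrumUpTo M = 0# ∷ signedFrom 1 M

    located-cong : ∀ {x y L} → x ≈ y → Located x L → Located y L
    located-cong e (ks , k , ls , p , x≈k , as) =
      ks , k , ls , p , ≈-trans (≈-sym e) x≈k , All.map (apart-cong e ≈-refl) as

    locate-sign : ∀ M N s → N ≤ M → Located (sign s * fromℕ N) (spectrumUpTo M)
    locate-sign M zero s _ = located-cong (≈-sym (zeroʳ _))
      ([] , 0# , _ , refl , ≈-refl , signedFrom-apart 1 M
        (λ m 0<m → apart-sym (apart-< 0<m) , apart-cong -0#≈0# ≈-refl (apart-neg (apart-sym (apart-< 0<m)))))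
    locate-sign M (suc N) s N≤M with locate-signed 1 M (suc N) z<s (s≤s z≤n) (s≤s N≤M) | sign-cases s
    ... | pos , neg | inj₁ e = located-cong (≈-sym (≈-trans (*-congʳ e) (*-identityˡ _)))
            (located-∷ (apart-< (z<s {n = N})) pos)
    ... | pos , neg | inj₂ e = located-cong
            (≈-sym (≈-trans (*-congʳ e) (≈-trans (≈-sym (-‿distribˡ-* _ _)) (-‿cong (*-identityˡ _)))))
            (located-∷ (apart-cong ≈-refl -0#≈0# (apart-neg (apart-< (z<s {n = N})))) neg)

    -- Triangularity and the annihilating polynomial

    module _ {n} (W : KΣ n) (W-sign : ∀ G → IsFace G → W G ≈ sign (n ∸ length G)) (α : List ℕ) where

      RWB : KΣ n → KΣ n
      RWB φ = R W (R (B̃ α) φ)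

      RWB-linear : IsLinear RWB
      RWB-linear = ∘-linear (R-linear W) (R-linear (B̃ α))

      open Shifts RWB RWB-linear

      -- `F · G` is longer than `F` unless `F ⪯ G`, and proper refinements of `F` are longer than
      -- `F`, so both factors act diagonally at `F`.
      RWB-triangular : ∀ r φ → (∀ F → IsFace F → r < length F → φ F ≈ 0#) →
        ∀ F → IsFace F → r ≤ length F → RWB φ F ≈ ñ α F * φ F
      RWB-triangular r φ z F f le = begin
        R W (R (B̃ α) φ) F
          ≈⟨ RW-diagonal W W-sign _ F f (λ H h lt → ≈-trans (RBφ H h (ℕₚ.≤-trans le (ℕₚ.<⇒≤ lt)))
               (≈-trans (*-congˡ (z H h (ℕₚ.≤-<-trans le lt))) (zeroʳ _))) ⟩
        sign (n ∸ length F) * R (B̃ α) φ F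
          ≈⟨ *-congˡ (RBφ F f le) ⟩
        sign (n ∸ length F) * (fromℕ (knapsack α F) * φ F)
          ≈⟨ *-assoc _ _ _ ⟨
        ñ α F * φ F ∎
        where
        RBφ : ∀ F → IsFace F → r ≤ length F → R (B̃ α) φ F ≈ fromℕ (knapsack α F) * φ F
        RBφ F f le = RB-diagonal α φ F f (λ G i _ ¬⪯ → let g = enum-faces n .sound i in
          z (F · G) (isFace-· f g) (ℕₚ.≤-<-trans le (⋠⇒longer f g ¬⪯)))

      -- The knapsack filtration seen on the dual side: these functions annihilate the span of the
      -- faces of knapsack number above `m`.
      VanishesAbove : ℕ → KΣ n → Set ℓ′
      VanishesAbove m φ = ∀ F → IsFace F → m < knapsack α F → φ F ≈ 0#

      -- Where the knapsack number exceeds `m`, both sides vanish. Having the constant `m` at all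
      -- these faces lets it pass through `R W`, which evaluates at the products `F · G`.
      RB-top : ∀ m φ → VanishesAbove m φ → ∀ F → IsFace F → m ≤ knapsack α F →
        R (B̃ α) φ F ≈ fromℕ m * φ F
      RB-top m φ z F f le = ≈-trans
        (RB-diagonal α φ F f (λ G i t ¬⪯ → z (F · G) (isFace-· f (enum-faces n .sound i))
           (ℕₚ.≤-<-trans le (knapsack-·-< α F G i t ¬⪯))))
        (level (ℕₚ.m≤n⇒m<n∨m≡n le))
        where
        level : m < knapsack α F ⊎ m ≡ knapsack α F → fromℕ (knapsack α F) * φ F ≈ fromℕ m * φ F
        level (inj₁ lt) = ≈-trans (*-congˡ (z F f lt)) (≈-trans (zeroʳ _) (≈-sym (≈-trans (*-congˡ (z F f lt)) (zeroʳ _))))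
        level (inj₂ eq) = reflexive (cong (λ k → fromℕ k * φ F) (sym eq))

      RWB-top : ∀ m φ → VanishesAbove m φ → ∀ F → IsFace F → m ≤ knapsack α F →
        RWB φ F ≈ fromℕ m * R W φ F
      RWB-top m φ z F f le = ≈-trans
        (R-cong-at W (R (B̃ α) φ) (fromℕ m • φ) F (λ G g → RB-top m φ z (F · G) (isFace-· f g) (ℕₚ.≤-trans le (knapsack-· α F G))))
        (op-• (R-linear W) (fromℕ m) φ F f)

      RWB-vanishes : ∀ m φ → VanishesAbove m φ → VanishesAbove m (RWB φ)
      RWB-vanishes m φ z F f lt = ≈-trans (RWB-top m φ z F f (ℕₚ.<⇒≤ lt))
        (≈-trans (*-congˡ (sum-zero (faces n) (λ {G} i →
           ≈-trans (*-congˡ (z (F · G) (isFace-· f (enum-faces n .sound i)) (ℕₚ.<-≤-trans lt (knapsack-· α F G)))) (zeroʳ _)))) (zeroʳ _))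

      -- On the faces of knapsack number m, RWB acts as m times the involution R W, modulo larger knapsack numbers.
      RWB²-top : ∀ m φ → VanishesAbove m φ → ∀ F → IsFace F → m ≤ knapsack α F →
        RWB (RWB φ) F ≈ fromℕ m * (fromℕ m * φ F)
      RWB²-top m φ z F f le = begin
        RWB (RWB φ) F
          ≈⟨ RWB-top m (RWB φ) (RWB-vanishes m φ z) F f le ⟩
        fromℕ m * R W (RWB φ) F
          ≈⟨ *-congˡ (R-cong-at W (RWB φ) (fromℕ m • R W φ) F (λ G g → RWB-top m φ z (F · G) (isFace-· f g) (ℕₚ.≤-trans le (knapsack-· α F G)))) ⟩
        fromℕ m * R W (fromℕ m • R W φ) F
          ≈⟨ *-congˡ (op-• (R-linear W) (fromℕ m) (R W φ) F f) ⟩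
        fromℕ m * (fromℕ m * R W (R W φ) F)
          ≈⟨ *-congˡ (*-congˡ (RW-involutive W W-sign φ F f)) ⟩
        fromℕ m * (fromℕ m * φ F) ∎

      -- The mixed terms cancel, leaving the square of `RWB` minus m², which is zero here by
      -- `RWB²-top`. The function that results vanishes from `m` on, one layer more than `φ`.
      pair-lowers : ∀ m φ → VanishesAbove m φ → ∀ F → IsFace F → m ≤ knapsack α F →
        prodOp (fromℕ m ∷ - fromℕ m ∷ []) φ F ≈ 0#
      pair-lowers m φ z F f le = begin
        RWB (shift (- a) φ) F - a * shift (- a) φ F
          ≈⟨ +-congʳ (A-shift (- a) φ F f) ⟩
        (RWB (RWB φ) F - - a * RWB φ F) - a * (RWB φ F - - a * φ F)
          ≈⟨ +-cong (+-congˡ (negneg a (RWB φ F))) (-‿cong (*-congˡ (+-congˡ (negneg a (φ F))))) ⟩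
        (RWB (RWB φ) F + a * RWB φ F) - a * (RWB φ F + a * φ F)
          ≈⟨ +-congˡ (-‿cong (≈-trans (distribˡ a _ _) (+-comm _ _))) ⟩
        (RWB (RWB φ) F + a * RWB φ F) - (a * (a * φ F) + a * RWB φ F)
          ≈⟨ x≈y⇒x∙y⁻¹≈ε (+-congʳ (RWB²-top m φ z F f le)) ⟩
        0# ∎
        where
        a = fromℕ m
        negneg : ∀ x y → - (- x * y) ≈ x * y
        negneg x y = ≈-trans (-‿cong (≈-sym (-‿distribˡ-* x y))) (-‿involutive _)

      signed-annihilates : ∀ k r φ → (∀ F → knapsack {n} α F < k ℕ.+ r) →
        ∀ F → IsFace F → k ≤ knapsack α F → prodOp (signedFrom k r) φ F ≈ 0#
      signed-annihilates k zero φ bound F f le =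
        ⊥-elim (ℕₚ.<⇒≱ (bound F) (subst (_≤ knapsack α F) (sym (ℕₚ.+-identityʳ k)) le))
      signed-annihilates k (suc r) φ bound F f le =
        -- Induction provides vanishing from `suc k` on, which is definitionally `VanishesAbove k`.
        pair-lowers k (prodOp (signedFrom (suc k) r) φ)
          (signed-annihilates (suc k) r φ (λ F → subst (knapsack α F <_) (ℕₚ.+-suc k r) (bound F))) F f le

      annihilates : ∀ φ → prodOp (spectrumUpTo (length (faces n))) φ ≈ᵥ 0ᵥ
      annihilates φ F f = begin
        -- Only knapsack number 0 is left, where the constant in `RWB-top` is 0, so a single factor
        -- for the root 0 suffices.
        RWB ψ F - 0# * ψ F        ≈⟨ +-cong (RWB-top 0 ψ ψ-zero F f z≤n) (≈-trans (-‿cong (zeroˡ _)) -0#≈0#) ⟩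
        0# * R W ψ F + 0#       ≈⟨ ≈-trans (+-identityʳ _) (zeroˡ _) ⟩
        0#                      ∎
        where
        ψ = prodOp (signedFrom 1 (length (faces n))) φ
        ψ-zero : VanishesAbove 0 ψ
        ψ-zero = signed-annihilates 1 (length (faces n)) φ (λ F → s≤s (knapsack-≤ α F))

      eigenbasis-WB : HasEigenbasis n (λ x → (x ⋆ W) ⋆ B̃ α) (ñ α)
      eigenbasis-WB = Diagonalization.eigenbasis RWB RWB-linear (λ x → (x ⋆ W) ⋆ B̃ α)
        (λ x H _ → ⋆⋆-R x W (B̃ α) H) (ñ α) RWB-triangular
        (spectrumUpTo (length (faces n))) annihilates
        (λ F → locate-sign (length (faces n)) (knapsack α F) (n ∸ length F) (knapsack-≤ α F))

-- Compositions, subsets and descent sets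

increment : List ℕ → List ℕ
increment []       = []
increment (b ∷ bs) = suc b ∷ bs

-- The composition β of m + 1 with D(β) = { i + 1 : i ∈ S }.
comp : Subset m → List ℕ
comp []          = 1 ∷ []
comp (true ∷ S)  = 1 ∷ comp S
comp (false ∷ S) = increment (comp S)

comp-shape : (S : Subset m) → ∃₂ λ b bs → comp S ≡ suc b ∷ bs
comp-shape []          = 0 , [] , refl
comp-shape (true ∷ S)  = 0 , comp S , refl
comp-shape (false ∷ S) with comp S | comp-shape S
... | _ | b , bs , refl = suc b , bs , refl

comp-composition : (S : Subset m) → IsComposition (suc m) (comp S)
comp-composition []          = z<s ∷ [] , refl
comp-composition (true ∷ S)  = let ps , e = comp-composition S in z<s ∷ ps , cong suc e
comp-composition (false ∷ S) with comp S | comp-shape S | comp-composition S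
... | _ | b , bs , refl | _ ∷ ps , e = z<s ∷ ps , cong suc e

-- A first part 1 is read as the bit `true`; a larger first part is lowered by one and read as
-- `false`.
comp-surjective : ∀ m β → IsComposition (suc m) β → Σ (Subset m) λ S → comp S ≡ β
comp-surjective zero    (1 ∷ [])           (_ , e) = [] , refl
comp-surjective zero    (1 ∷ suc c ∷ bs)   (_ , ())
comp-surjective zero    (suc (suc b) ∷ bs) (_ , ())
comp-surjective (suc m) (1 ∷ [])           (_ , ())
comp-surjective (suc m) (1 ∷ c ∷ bs)       (_ ∷ ps , e) with comp-surjective m (c ∷ bs) (ps , ℕₚ.suc-injective e)
... | S , e′ = true ∷ S , cong (1 ∷_) e′
comp-surjective (suc m) (suc (suc b) ∷ bs) (_ ∷ ps , e) with comp-surjective m (suc b ∷ bs) (z<s ∷ ps , ℕₚ.suc-injective e)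
... | S , e′ = false ∷ S , cong increment e′
comp-surjective zero    (1 ∷ zero ∷ bs)    (_ ∷ () ∷ _ , _)
comp-surjective m       (zero ∷ bs)        (() ∷ _ , _)

D-1∷comp : (S : Subset m) → D (comp (true ∷ S)) ≡ 1 ∷ map suc (D (comp S))
D-1∷comp S with comp S | comp-shape S
... | _ | b , bs , refl = refl

D-increment : ∀ b bs → D (increment (b ∷ bs)) ≡ map suc (D (b ∷ bs))
D-increment b []       = refl
D-increment b (c ∷ bs) = cong (suc b ∷_) (Listₚ.map-∘ (D (c ∷ bs)))

D-comp-false : (S : Subset m) → D (comp (false ∷ S)) ≡ map suc (D (comp S))
D-comp-false S with comp S | comp-shape S
... | _ | b , bs , refl = D-increment (suc b) bs

∈-map-suc⁻ : {k : ℕ} {xs : List ℕ} → suc k ∈ map suc xs → k ∈ xs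
∈-map-suc⁻ i with ∈-map⁻ ℕ.suc i
... | _ , i′ , refl = i′

0∉map-suc : {xs : List ℕ} → ¬ 0 ∈ map suc xs
0∉map-suc i with ∈-map⁻ ℕ.suc i
... | _ , _ , ()

0∉D-comp : (S : Subset m) → ¬ 0 ∈ D (comp S)
0∉D-comp [] ()
0∉D-comp (true ∷ S)  i with subst (0 ∈_) (D-1∷comp S) i
... | there i′ = 0∉map-suc i′
0∉D-comp (false ∷ S) i = 0∉map-suc (subst (0 ∈_) (D-comp-false S) i)

∈D-comp⁺ : (S : Subset m) (i : Fin m) → i ∈ₛ S → suc (toℕ i) ∈ D (comp S)
∈D-comp⁺ (true ∷ S)  zero    here      = subst (1 ∈_) (sym (D-1∷comp S)) (here refl)
∈D-comp⁺ (true ∷ S)  (suc i) (there p) = subst (_ ∈_) (sym (D-1∷comp S)) (there (∈-map⁺ suc (∈D-comp⁺ S i p)))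
∈D-comp⁺ (false ∷ S) (suc i) (there p) = subst (_ ∈_) (sym (D-comp-false S)) (∈-map⁺ suc (∈D-comp⁺ S i p))

∈D-comp⁻ : (S : Subset m) (i : Fin m) → suc (toℕ i) ∈ D (comp S) → i ∈ₛ S
∈D-comp⁻ (true ∷ S)  zero    _ = here
∈D-comp⁻ (true ∷ S)  (suc i) p with subst (suc (suc (toℕ i)) ∈_) (D-1∷comp S) p
... | there p′ = there (∈D-comp⁻ S i (∈-map-suc⁻ p′))
∈D-comp⁻ (false ∷ S) zero    p = ⊥-elim (0∉D-comp S (∈-map-suc⁻ (subst (1 ∈_) (D-comp-false S) p)))
∈D-comp⁻ (false ∷ S) (suc i) p = there (∈D-comp⁻ S i (∈-map-suc⁻ (subst (suc (suc (toℕ i)) ∈_) (D-comp-false S) p)))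

comp-injective : (S S′ : Subset m) → comp S ≡ comp S′ → S ≡ S′
comp-injective S S′ e = Subₚ.⊆-antisym
  (λ {i} p → ∈D-comp⁻ S′ i (subst (λ β → suc (toℕ i) ∈ D β) e (∈D-comp⁺ S i p)))
  (λ {i} p → ∈D-comp⁻ S i (subst (λ β → suc (toℕ i) ∈ D β) (sym e) (∈D-comp⁺ S′ i p)))

composition-bounds : ∀ β → IsComposition n β → All (_< suc n) β × length β < suc n
composition-bounds β (ps , refl) = All.map s≤s (entries β) , s≤s (len β ps)
  where
  entries : ∀ β → All (_≤ sum β) β
  entries []       = []
  entries (b ∷ bs) = ℕₚ.m≤m+n b (sum bs) ∷ All.map (λ le → ℕₚ.≤-trans le (ℕₚ.m≤n+m (sum bs) b)) (entries bs)
  len : ∀ β → All (0 <_) β → length β ≤ sum β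
  len []       []       = z≤n
  len (b ∷ bs) (p ∷ ps) = ℕₚ.+-mono-≤ p (len bs ps)

-- Bit `i` stands for the descent position i + 1, the convention of `comp`.
descents : Permutation′ (suc m) → Subset m
descents w = tabulate (λ i → does (toℕ (w ⟨$⟩ʳ suc i) <? toℕ (w ⟨$⟩ʳ inject₁ i)))

∈descents⁺ : (w : Permutation′ (suc m)) (i : Fin m) →
  toℕ (w ⟨$⟩ʳ suc i) < toℕ (w ⟨$⟩ʳ inject₁ i) → i ∈ₛ descents w
∈descents⁺ w i lt = Vecₚ.lookup⇒[]= i (descents w) (trans (Vecₚ.lookup∘tabulate _ i) (dec-true (_ <? _) lt))

∈descents⁻ : (w : Permutation′ (suc m)) (i : Fin m) → i ∈ₛ descents w →
  toℕ (w ⟨$⟩ʳ suc i) < toℕ (w ⟨$⟩ʳ inject₁ i)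
∈descents⁻ w i p = decide (toℕ (w ⟨$⟩ʳ suc i) <? toℕ (w ⟨$⟩ʳ inject₁ i))
  (trans (sym (Vecₚ.lookup∘tabulate (λ i → does (toℕ (w ⟨$⟩ʳ suc i) <? toℕ (w ⟨$⟩ʳ inject₁ i))) i)) (Vecₚ.[]=⇒lookup p))
  where
  decide : {P : Set} (P? : Dec P) → does P? ≡ true → P
  decide (yes x) _ = x

valAt-toℕ : (w : Permutation′ n) (i : Fin n) → valAt w (toℕ i) ≡ toℕ (w ⟨$⟩ʳ i)
valAt-toℕ {n} w i with toℕ i <? n
... | yes p = cong (λ j → toℕ (w ⟨$⟩ʳ j)) (Finₚ.fromℕ<-toℕ i p)
... | no ¬p = ⊥-elim (¬p (Finₚ.toℕ<n i))

valAt-inject₁ : (w : Permutation′ (suc m)) (i : Fin m) → valAt w (toℕ i) ≡ toℕ (w ⟨$⟩ʳ inject₁ i)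
valAt-inject₁ w i = trans (cong (valAt w) (sym (Finₚ.toℕ-inject₁ i))) (valAt-toℕ w (inject₁ i))

desIn⇒⊆ : (w : Permutation′ (suc m)) (S : Subset m) → DesIn w (comp S) → descents w ⊆ S
desIn⇒⊆ {m} w S h {i} p = ∈D-comp⁻ S i (All.lookup h
  (∈-filter⁺ (λ i → valAt w i <? valAt w (i ∸ 1)) (∈-map⁺ suc (∈-upTo⁺ (Finₚ.toℕ<n i)))
    (subst₂ _<_ (sym (valAt-toℕ w (suc i))) (sym (valAt-inject₁ w i)) (∈descents⁻ w i p))))

⊆⇒desIn : (w : Permutation′ (suc m)) (S : Subset m) → descents w ⊆ S → DesIn w (comp S)
⊆⇒desIn {m} w S sub = All.tabulate λ p →
  let p₁ , lt = ∈-filter⁻ (λ i → valAt w i <? valAt w (i ∸ 1)) {xs = map suc (upTo m)} p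
      j , j∈ , e = ∈-map⁻ suc p₁
  in subst (_∈ D (comp S)) (sym e) (step j (∈-upTo⁻ j∈) (subst (λ k → valAt w k < valAt w (k ∸ 1)) e lt))
  where
  step : ∀ j → j < m → valAt w (suc j) < valAt w j → suc j ∈ D (comp S)
  step j j<m lt with fromℕ< j<m | Finₚ.toℕ-fromℕ< j<m
  ... | i | refl = ∈D-comp⁺ S i (sub (∈descents⁺ w i
    (subst₂ _<_ (valAt-toℕ w (suc i)) (valAt-inject₁ w i) lt)))

decreasing-lower : ∀ m (v : Fin (suc m) → ℕ) → (∀ i → v (suc i) < v (inject₁ i)) → m ≤ v zero
decreasing-lower zero    v dec = z≤n
decreasing-lower (suc m) v dec = ℕₚ.≤-trans (s≤s (decreasing-lower m (v ∘ suc) (dec ∘ suc))) (dec zero)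

-- A start of at most `m` leaves just enough room for `m` strict descents, so every step is exactly
-- 1.
decreasing-forced : ∀ m (v : Fin (suc m) → ℕ) → (∀ i → v (suc i) < v (inject₁ i)) → v zero ≤ m →
  ∀ i → v i ≡ m ∸ toℕ i
decreasing-forced m       v dec le zero    = ℕₚ.≤-antisym le (decreasing-lower m v dec)
decreasing-forced (suc m) v dec le (suc i) = decreasing-forced m (v ∘ suc) (dec ∘ suc)
  (ℕ.s≤s⁻¹ (ℕₚ.≤-trans (dec zero) le)) i

w₀-descents : (w : Permutation′ (suc m)) → IsW0 w → descents w ≡ ⊤
w₀-descents {m} w h = Subₚ.⊆-antisym Subₚ.⊆⊤ (λ {i} _ → ∈descents⁺ w i
  (subst₂ _<_ (sym (h (suc i))) (sym (trans (h (inject₁ i)) (cong (m ∸_) (Finₚ.toℕ-inject₁ i))))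
    (ℕₚ.∸-monoʳ-< (ℕₚ.n<1+n (toℕ i)) (Finₚ.toℕ<n i))))

descents-w₀ : (w : Permutation′ (suc m)) → descents w ≡ ⊤ → IsW0 w
descents-w₀ {m} w e = decreasing-forced m (λ i → toℕ (w ⟨$⟩ʳ i))
  (λ i → ∈descents⁻ w i (subst (i ∈ₛ_) (sym e) Subₚ.∈⊤)) (Finₚ.toℕ≤pred[n] (w ⟨$⟩ʳ zero))

-- Putting the largest value first creates a descent at the front, the smallest an ascent, and
-- comparisons among the remaining values are unchanged. Thus every subset can be tested as a
-- descent set.
permWithDescents : Subset m → Permutation′ (suc m)
permWithDescents []              = idₚ
permWithDescents {suc m} (true ∷ S)  = insert zero (maxFin (suc m)) (permWithDescents S)
permWithDescents (false ∷ S) = insert zero zero (permWithDescents S)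

toℕ-punchIn-maxFin : ∀ m (i : Fin m) → toℕ (punchIn (maxFin m) i) ≡ toℕ i
toℕ-punchIn-maxFin (suc m) zero    = refl
toℕ-punchIn-maxFin (suc m) (suc i) = cong suc (toℕ-punchIn-maxFin m i)

descents-perm : (S : Subset m) → descents (permWithDescents S) ≡ S
descents-perm [] = refl
descents-perm {suc m} (true ∷ S) = cong₂ _∷_
  (dec-true (_ <? _) (subst₂ _<_ (sym (val zero)) (sym (Finₚ.toℕ-fromℕ (suc m))) (Finₚ.toℕ<n _)))
  (trans (Vecₚ.tabulate-cong (λ i → cong₂ (λ a b → does (a <? b)) (val (suc i)) (val (inject₁ i)))) (descents-perm S))
  where
  w = permWithDescents S
  val : ∀ i → toℕ (insert zero (maxFin (suc m)) w ⟨$⟩ʳ suc i) ≡ toℕ (w ⟨$⟩ʳ i)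
  val i = trans (cong toℕ (insert-punchIn zero (maxFin (suc m)) w i)) (toℕ-punchIn-maxFin (suc m) _)
descents-perm {suc m} (false ∷ S) = cong₂ _∷_
  (dec-false (toℕ (insert zero zero w ⟨$⟩ʳ suc zero) <? 0) (λ ()))
  (trans (Vecₚ.tabulate-cong (λ i → cong₂ (λ a b → does (a <? b)) (val (suc i)) (val (inject₁ i)))) (descents-perm S))
  where
  w = permWithDescents S
  val : ∀ i → toℕ (insert zero zero w ⟨$⟩ʳ suc i) ≡ suc (toℕ (w ⟨$⟩ʳ i))
  val i = cong toℕ (insert-punchIn zero zero w i)

type-composition : {F : Face n} → IsFace F → IsComposition n (type F)
type-composition {n} {F} f = positive F (proj₁ f) , trans (total F (isFace⇒faceOf f)) (Subₚ.∣⊤∣≡n n)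
  where
  positive : ∀ F → All _ F → All (0 <_) (type F)
  positive []      []       = []
  positive (X ∷ F) (x ∷ xs) = nonempty-size x ∷ positive F xs
  total : ∀ {A : Subset n} F → FaceOf A F → sum (type F) ≡ ∣ A ∣
  total []      refl            = sym (Subₚ.∣⊥∣≡0 n)
  total (X ∷ F) (_ , q , s , f) = trans (cong (∣ X ∣ ℕ.+_) (total F f)) (sym (split-size s))

-- Coordinates of w₀ in the basis B_β

module Coordinates {c ℓ′} (𝕜 : Field c ℓ′) where
  open Field 𝕜 hiding (refl; sym; trans; zero)
  open OverField 𝕜
  open FieldSums 𝕜
  open FaceSums 𝕜
  open import Relation.Binary.Reasoning.Setoid setoid
  open import Algebra.Properties.Ring ring using (-‿distribˡ-*; +-cancelˡ)
  open Enumerates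

  enum-compositions : ∀ n → Enumerates (Listₚ.≡-dec ℕ._≟_) (IsComposition n) (compositions n)
  enum-compositions n = enum-lists ℕ._≟_
    (record { sound = ∈-upTo⁻ ; sift = λ k lt φ → sift-upTo (suc n) k lt φ })
    (isComposition? n) (suc n) composition-bounds

  enum-comp : ∀ m → Enumerates (Listₚ.≡-dec ℕ._≟_) (IsComposition (suc m)) (map comp (allSubsets m))
  enum-comp m .sound i with ∈-map⁻ comp i
  ... | S , _ , refl = comp-composition S
  enum-comp m .sift β h φ with comp-surjective m β h
  ... | S , refl = begin
    _ ≈⟨ reflexive (sum-map comp (allSubsets m) _) ⟩
    sumOver (allSubsets m) (λ S′ → [ comp S ≟ₗ comp S′ ] * φ (comp S′))
      ≈⟨ sum-cong (allSubsets m) (λ S′ → *-congʳ ([⇔] (comp S ≟ₗ comp S′) (S ≟ₛ S′) (comp-injective S S′) (cong comp))) ⟩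
    sumOver (allSubsets m) (λ S′ → [ S ≟ₛ S′ ] * φ (comp S′))
      ≈⟨ enum-subsets m .sift S tt (φ ∘ comp) ⟩
    φ (comp S) ∎
    where _≟ₗ_ = Listₚ.≡-dec ℕ._≟_

  -- `comp` identifies compositions with subsets and turns the descent condition into inclusion, so
  -- coefficients become sums over supersets.
  sum-compositions : ∀ m (γ : List ℕ → Carrier) (w : Permutation′ (suc m)) →
    sumOver (compositions (suc m)) (λ β → γ β * [ desIn? w β ]) ≈
    sumOver (allSubsets m) (λ S → γ (comp S) * [ descents w ⊆? S ])
  sum-compositions m γ w = begin
    _ ≈⟨ sum-enum (Listₚ.≡-dec ℕ._≟_) (enum-compositions (suc m)) (enum-comp m) _ ⟩
    _ ≈⟨ reflexive (sum-map comp (allSubsets m) _) ⟩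
    _ ≈⟨ sum-cong (allSubsets m) (λ S → *-congˡ
           ([⇔] (desIn? w (comp S)) (descents w ⊆? S) (λ h {i} → desIn⇒⊆ w S h {i}) (⊆⇒desIn w S))) ⟩
    _ ∎

  sum-subsets : ∀ m (f : Subset (suc m) → Carrier) →
    sumOver (allSubsets (suc m)) f ≈ sumOver (allSubsets m) (f ∘ (true ∷_)) + sumOver (allSubsets m) (f ∘ (false ∷_))
  sum-subsets m f = begin
    _ ≈⟨ sum-concatMap _ (allSubsets m) f ⟩
    sumOver (allSubsets m) (λ S → f (true ∷ S) + (f (false ∷ S) + 0#))
      ≈⟨ sum-cong (allSubsets m) (λ S → +-congˡ (+-identityʳ _)) ⟩
    sumOver (allSubsets m) (λ S → f (true ∷ S) + f (false ∷ S))
      ≈⟨ sum-+ (allSubsets m) _ _ ⟩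
    _ ∎

  tt⊆ : (R S : Subset m) → [ (true ∷ R) ⊆? (true ∷ S) ] ≈ [ R ⊆? S ]
  tt⊆ R S = [⇔] ((true ∷ R) ⊆? (true ∷ S)) (R ⊆? S) (λ h {i} → Subₚ.drop-∷-⊆ h {i}) (λ h {i} → Subₚ.in⊆in h {i})

  f⊆ : (R S : Subset m) (b : Bool) → [ (false ∷ R) ⊆? (b ∷ S) ] ≈ [ R ⊆? S ]
  f⊆ R S b = [⇔] ((false ∷ R) ⊆? (b ∷ S)) (R ⊆? S) (λ h {i} → Subₚ.drop-∷-⊆ h {i}) (λ h {i} → Subₚ.out⊆ h {i})

  tf⊆ : (R S : Subset m) → [ (true ∷ R) ⊆? (false ∷ S) ] ≈ 0#
  tf⊆ R S = [no] ((true ∷ R) ⊆? (false ∷ S)) (λ h → absurd (h here))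
    where
    absurd : ¬ (zero ∈ₛ false ∷ S)
    absurd ()

  upSum : (Subset m → Carrier) → Subset m → Carrier
  upSum {m} f R = sumOver (allSubsets m) (λ S → f S * [ R ⊆? S ])

  upSum-true : (f : Subset (suc m) → Carrier) (R : Subset m) → upSum f (true ∷ R) ≈ upSum (f ∘ (true ∷_)) R
  upSum-true {m} f R = begin
    _ ≈⟨ sum-subsets m _ ⟩
    _ ≈⟨ +-cong (sum-cong (allSubsets m) (λ S → *-congˡ (tt⊆ R S)))
                (sum-zero (allSubsets m) (λ {S} _ → ≈-trans (*-congˡ (tf⊆ R S)) (zeroʳ _))) ⟩
    _ ≈⟨ +-identityʳ _ ⟩
    _ ∎

  upSum-false : (f : Subset (suc m) → Carrier) (R : Subset m) →
    upSum f (false ∷ R) ≈ upSum (f ∘ (true ∷_)) R + upSum (f ∘ (false ∷_)) R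
  upSum-false {m} f R = begin
    _ ≈⟨ sum-subsets m _ ⟩
    _ ≈⟨ +-cong (sum-cong (allSubsets m) (λ S → *-congˡ (f⊆ R S true)))
                (sum-cong (allSubsets m) (λ S → *-congˡ (f⊆ R S false))) ⟩
    _ ∎

  -- Möbius inversion on the Boolean lattice, one bit at a time: the values at subsets containing
  -- the first element are recovered first and then cancelled.
  upSum-injective : ∀ m (f g : Subset m → Carrier) → (∀ R → upSum f R ≈ upSum g R) → ∀ S → f S ≈ g S
  upSum-injective zero f g e [] = begin
    f []                ≈⟨ *-identityʳ _ ⟨
    f [] * 1#           ≈⟨ +-identityʳ _ ⟨
    f [] * 1# + 0#      ≈⟨ e [] ⟩
    g [] * 1# + 0#      ≈⟨ +-identityʳ _ ⟩
    g [] * 1#           ≈⟨ *-identityʳ _ ⟩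
    g []                ∎
  upSum-injective (suc m) f g e = λ { (true ∷ S) → on-true S ; (false ∷ S) → on-false S }
    where
    on-true : ∀ S → f (true ∷ S) ≈ g (true ∷ S)
    on-true = upSum-injective m _ _
      (λ R → ≈-trans (≈-sym (upSum-true f R)) (≈-trans (e (true ∷ R)) (upSum-true g R)))
    on-false : ∀ S → f (false ∷ S) ≈ g (false ∷ S)
    on-false = upSum-injective m _ _ (λ R → +-cancelˡ (upSum (f ∘ (true ∷_)) R) _ _ (begin
      upSum (f ∘ (true ∷_)) R + upSum (f ∘ (false ∷_)) R  ≈⟨ upSum-false f R ⟨
      upSum f (false ∷ R)                                 ≈⟨ e (false ∷ R) ⟩
      upSum g (false ∷ R)                                 ≈⟨ upSum-false g R ⟩
      upSum (g ∘ (true ∷_)) R + upSum (g ∘ (false ∷_)) R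
        ≈⟨ +-congʳ (sum-cong (allSubsets m) (λ S → *-congʳ (on-true S))) ⟨
      upSum (f ∘ (true ∷_)) R + upSum (g ∘ (false ∷_)) R  ∎))

  -- Since `comp S` has one part more than `S` has elements, this is -1 to the number of elements
  -- missing from `S`.
  compSign : Subset m → Carrier
  compSign {m} S = sign (suc m ∸ length (comp S))

  compSign-false : (S : Subset m) → compSign (false ∷ S) ≈ - compSign S
  compSign-false {m} S with comp S | comp-shape S | proj₂ (composition-bounds (comp S) (comp-composition S))
  ... | _ | b , bs , refl | s≤s le = reflexive (cong sign (ℕₚ.+-∸-assoc 1 le))

  -- A position outside `R` may lie in `S` or not, with opposite signs, so everything cancels unless
  -- `R` is full.
  upSum-compSign : (R : Subset m) → upSum compSign R ≈ [ R ≟ₛ ⊤ ]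
  upSum-compSign [] = ≈-trans (+-identityʳ _) (*-identityˡ _)
  upSum-compSign (true ∷ R) = begin
    upSum compSign (true ∷ R)   ≈⟨ upSum-true compSign R ⟩
    upSum compSign R            ≈⟨ upSum-compSign R ⟩
    [ R ≟ₛ ⊤ ]                  ≈⟨ ∷≟∷ true R ⊤ ⟨
    [ (true ∷ R) ≟ₛ ⊤ ]         ∎
  upSum-compSign {suc m} (false ∷ R) = begin
    upSum compSign (false ∷ R)
      ≈⟨ upSum-false compSign R ⟩
    upSum compSign R + upSum (compSign ∘ (false ∷_)) R
      ≈⟨ +-congˡ (sum-cong (allSubsets m) (λ S → ≈-trans (*-congʳ (compSign-false S)) (≈-sym (-‿distribˡ-* _ _)))) ⟩
    upSum compSign R + sumOver (allSubsets m) (λ S → - (compSign S * [ R ⊆? S ]))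
      ≈⟨ +-congˡ (sum-neg (allSubsets m) _) ⟩
    upSum compSign R - upSum compSign R
      ≈⟨ -‿inverseʳ _ ⟩
    0#
      ≈⟨ ∷≢∷ {a = false} {b = true} (λ ()) R ⊤ ⟨
    [ (false ∷ R) ≟ₛ ⊤ ] ∎

  [w₀] : (w : Permutation′ (suc m)) → [ isW0? w ] ≈ [ descents w ≟ₛ ⊤ ]
  [w₀] w = [⇔] (isW0? w) (descents w ≟ₛ ⊤) (w₀-descents w) (descents-w₀ w)

  w₀-coords : ∀ n → CoordsOfW0 n (λ β → sign (n ∸ length β))
  w₀-coords zero    w = ≈-trans (+-identityʳ _) (*-identityˡ _)
  w₀-coords (suc m) w = begin
    _                        ≈⟨ sum-compositions m _ w ⟩
    upSum compSign (descents w) ≈⟨ upSum-compSign (descents w) ⟩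
    [ descents w ≟ₛ ⊤ ]      ≈⟨ [w₀] w ⟨
    [ isW0? w ]              ∎

  -- The linear independence of the B_β, tested on one permutation for every descent set.
  w₀-coords-unique : ∀ n γ → CoordsOfW0 n γ → ∀ β → IsComposition n β → γ β ≈ sign (n ∸ length β)
  w₀-coords-unique zero γ h [] _ = begin
    γ []             ≈⟨ *-identityʳ _ ⟨
    γ [] * 1#        ≈⟨ +-identityʳ _ ⟨
    γ [] * 1# + 0#   ≈⟨ h idₚ ⟩
    1#               ∎
  w₀-coords-unique zero γ h (zero ∷ β) (() ∷ _ , _)
  w₀-coords-unique zero γ h (suc b ∷ β) (_ , ())
  w₀-coords-unique (suc m) γ h β β-comp with comp-surjective m β β-comp
  ... | S , refl = upSum-injective m (γ ∘ comp) compSign (λ R → begin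
    upSum (γ ∘ comp) R
      ≈⟨ reflexive (cong (upSum (γ ∘ comp)) (descents-perm R)) ⟨
    upSum (γ ∘ comp) (descents (permWithDescents R))
      ≈⟨ sum-compositions m γ (permWithDescents R) ⟨
    sumOver (compositions (suc m)) (λ β → γ β * [ desIn? (permWithDescents R) β ])
      ≈⟨ h (permWithDescents R) ⟩
    [ isW0? (permWithDescents R) ]
      ≈⟨ [w₀] (permWithDescents R) ⟩
    [ descents (permWithDescents R) ≟ₛ ⊤ ]
      ≈⟨ reflexive (cong (λ R → [ R ≟ₛ ⊤ ]) (descents-perm R)) ⟩
    [ R ≟ₛ ⊤ ]
      ≈⟨ upSum-compSign R ⟨
    upSum compSign R ∎) S

  -- Only `β` equal to `type G` contributes at `G`, and it has as many parts as `G` has blocks.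
  ρ̃-w₀ : ∀ n γ → CoordsOfW0 n γ → ∀ G → IsFace G → ρ̃ n γ G ≈ sign (n ∸ length G)
  ρ̃-w₀ n γ h G g = begin
    sumOver (compositions n) (λ β → γ β * [ Listₚ.≡-dec ℕ._≟_ (type G) β ])
      ≈⟨ sum-cong (compositions n) (λ β → *-comm _ _) ⟩
    sumOver (compositions n) (λ β → [ Listₚ.≡-dec ℕ._≟_ (type G) β ] * γ β)
      ≈⟨ enum-compositions n .sift (type G) (type-composition g) γ ⟩
    γ (type G)
      ≈⟨ w₀-coords-unique n γ h (type G) (type-composition g) ⟩
    sign (n ∸ length (type G))
      ≈⟨ reflexive (cong (λ l → sign (n ∸ l)) (Listₚ.length-map ∣_∣ G)) ⟩
    sign (n ∸ length G) ∎

theorem8p2 : ∀ {c ℓ′} (𝕜 : Field c ℓ′) → OverField.CharZero 𝕜 →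
    (n : ℕ) (α : List ℕ) → IsComposition n α →
    Σ (List ℕ → Field.Carrier 𝕜) (OverField.CoordsOfW0 𝕜 n)
    × (∀ (γ : List ℕ → Field.Carrier 𝕜) → OverField.CoordsOfW0 𝕜 n γ →
    OverField.HasEigenbasis 𝕜 n
    (λ x → OverField._⋆_ 𝕜 (OverField._⋆_ 𝕜 x (OverField.ρ̃ 𝕜 n γ)) (OverField.B̃ 𝕜 α))
    (OverField.ñ 𝕜 α))
theorem8p2 𝕜 char0 n α _ =
    -- The witness is `λ β → sign (n ∸ length β)`, so the quantification over `γ` is not vacuous.
    (_ , Coordinates.w₀-coords 𝕜 n)
  , λ γ h → Operators.eigenbasis-WB 𝕜 char0 _ (Coordinates.ρ̃-w₀ 𝕜 n γ h) α
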